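{- For a linear order $M$: $M\in\underline{M}$ if and only if $M$ is countable and satisfies some monadic sentence which is $(\le\aleph_0)$-categorical.
   Context: $\underline{M}$ is the family of linear orders (considered up to isomorphism) that is the closure of $\{1\}$ (the one-element order) under the following operations: (1) the ordered sum $M+N$; (2) $M\mapsto M\cdot\omega$ and $M\mapsto M\cdot\omega^*$, the ordered sums of copies of $M$ indexed by $\omega$ and by $\omega^*$ (the reverse of $\omega$) respectively; (3) for finitely many $M_0,\dots,M_{n-1}$ ($n\ge1$), the shuffle $\sum^*_{i<n}M_i$, which is the ordered sum $\sum_{a\in\mathbb{Q}}M_a$, where each $M_a\in\{M_i:i<n\}$ and for each $i<n$ the set $\{a\in\mathbb{Q}:M_a=M_i\}$ is a dense subset of the rationals. Structures are nonempty; "countable" means of cardinality $\le\aleph_0$. Monadic sentences are sentences of monadic second-order logic (first-order logic with quantification over arbitrary subsets of the universe) in the language $\{<\}$ of order. A monadic sentence $\psi$ is $(\le\aleph_0)$-categorical if any two linear orders of cardinality $\le\aleph_0$ which satisfy $\psi$ are isomorphic. -}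

module Defs where

open import Data.Bool.Base as Bool using (Bool; true; false; if_then_else_)
import Data.Bool.Properties as Bool
open import Data.Fin.Base as Fin using (Fin; zero)
import Data.Fin.Properties as Fin
open import Data.Nat.Base as ℕ using (ℕ; suc)
import Data.Nat.Properties as ℕ
open import Data.Product using (Σ; ∃; ∃-syntax; _×_; _,_)
open import Data.Rational.Base as ℚ using (ℚ)
import Data.Rational.Properties as ℚ
open import Data.Vec.Functional using (Vector; []; _∷_)
open import Function.Base using (flip; const)
open import Function.Bundles using (_↣_)
open import Level using (0ℓ; Lift) renaming (suc to lsuc)
open import Relation.Binary.Core using (Rel)
open import Relation.Binary.Definitions using (Trichotomous; Transitive; tri<; tri≈; tri>)
import Relation.Binary.Construct.Flip.EqAndOrd as Flip
open import Relation.Binary.Morphism.Structures using (IsOrderIsomorphism)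
open import Relation.Binary.PropositionalEquality
  using (_≡_; refl; cong; isEquivalence)
open import Relation.Binary.Structures using (IsStrictTotalOrder)
open import Relation.Binary.Structures.Biased using (isStrictTotalOrderᶜ)
open import Relation.Nullary using (¬_)
open import Relation.Unary using (Pred; _∈_)

-- Structures are nonempty, hence the last field. `_≅_` below does not require
-- the chosen point to be preserved.

record LinearOrder : Set₁ where
  field
    Carrier            : Set
    _<_                : Rel Carrier 0ℓ
    isStrictTotalOrder : IsStrictTotalOrder _≡_ _<_
    inhabited          : Carrier

open LinearOrder public using (Carrier)

infix 4 _≅_
_≅_ : LinearOrder → LinearOrder → Set
M ≅ N = ∃ (IsOrderIsomorphism _≡_ _≡_ (LinearOrder._<_ M) (LinearOrder._<_ N))

Countable : LinearOrder → Set
Countable M = Carrier M ↣ ℕ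

𝟏 : LinearOrder
𝟏 = record
  { Carrier            = Fin 1
  ; _<_                = Fin._<_
  ; isStrictTotalOrder = Fin.<-isStrictTotalOrder
  ; inhabited          = zero
  }

𝟐 : LinearOrder
𝟐 = record
  { Carrier            = Bool
  ; _<_                = Bool._<_
  ; isStrictTotalOrder = Bool.<-isStrictTotalOrder
  ; inhabited          = false
  }

ω : LinearOrder
ω = record
  { Carrier            = ℕ
  ; _<_                = ℕ._<_
  ; isStrictTotalOrder = ℕ.<-isStrictTotalOrder
  ; inhabited          = 0
  }

η : LinearOrder
η = record
  { Carrier            = ℚ
  ; _<_                = ℚ._<_
  ; isStrictTotalOrder = ℚ.<-isStrictTotalOrder
  ; inhabited          = ℚ.0ℚ
  }

infix 30 _ᵒᵖ
_ᵒᵖ : LinearOrder → LinearOrder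
M ᵒᵖ = record
  { Carrier            = M.Carrier
  ; _<_                = flip M._<_
  ; isStrictTotalOrder = Flip.isStrictTotalOrder M.isStrictTotalOrder
  ; inhabited          = M.inhabited
  }
  where module M = LinearOrder M

module OrderedSum (I : LinearOrder) (M : Carrier I → LinearOrder) where
  private
    module I = LinearOrder I
    module M i = LinearOrder (M i)
    module I< = IsStrictTotalOrder I.isStrictTotalOrder
    module M< i = IsStrictTotalOrder (M.isStrictTotalOrder i)

  infix 4 _<_
  data _<_ : Rel (Σ I.Carrier M.Carrier) 0ℓ where
    across : ∀ {i j x y} → i I.< j → (i , x) < (j , y)
    within : ∀ {i x y} → M._<_ i x y → (i , x) < (i , y)

  <-trans : Transitive _<_
  <-trans (across p) (across q) = across (I<.trans p q)
  <-trans (across p) (within _) = across p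
  <-trans (within _) (across q) = across q
  <-trans (within p) (within q) = within (M<.trans _ p q)

  <-compare : Trichotomous _≡_ _<_
  <-compare (i , x) (j , y) with I<.compare i j
  ... | tri< i<j i≢j i≯j = tri< (across i<j) (λ { refl → i≢j refl })
          λ { (across p) → i≯j p ; (within _) → i≢j refl }
  ... | tri> i≮j i≢j j<i = tri> (λ { (across p) → i≮j p ; (within _) → i≢j refl })
          (λ { refl → i≢j refl }) (across j<i)
  ... | tri≈ i≮i refl _ with M<.compare i x y
  ...   | tri< x<y x≢y x≯y = tri< (within x<y) (λ { refl → x≢y refl })
            λ { (across p) → i≮i p ; (within q) → x≯y q }
  ...   | tri≈ x≮y x≡y x≯y = tri≈ (λ { (across p) → i≮i p ; (within q) → x≮y q })
            (cong (i ,_) x≡y) λ { (across p) → i≮i p ; (within q) → x≯y q }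
  ...   | tri> x≮y x≢y y<x = tri> (λ { (across p) → i≮i p ; (within q) → x≮y q })
            (λ { refl → x≢y refl }) (within y<x)

∑ : (I : LinearOrder) → (Carrier I → LinearOrder) → LinearOrder
∑ I M = record
  { Carrier            = Σ (Carrier I) (λ i → Carrier (M i))
  ; _<_                = OrderedSum._<_ I M
  ; isStrictTotalOrder = isStrictTotalOrderᶜ record
      { isEquivalence = isEquivalence
      ; trans         = OrderedSum.<-trans I M
      ; compare       = OrderedSum.<-compare I M
      }
  ; inhabited          = _ , LinearOrder.inhabited (M (LinearOrder.inhabited I))
  }

infixl 6 _⊕_
_⊕_ : LinearOrder → LinearOrder → LinearOrder
M ⊕ N = ∑ 𝟐 (λ b → if b then N else M)

-- As usual for order types, M · I is I copies of M.

infixl 7 _·_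
_·_ : LinearOrder → LinearOrder → LinearOrder
M · I = ∑ I (const M)

DenseIn-ℚ : Pred ℚ 0ℓ → Set
DenseIn-ℚ D = ∀ {p q} → p ℚ.< q → ∃[ r ] r ∈ D × p ℚ.< r × r ℚ.< q

-- Equality of orders is read up to isomorphism, so no colour of ℚ is
-- attached to an index: indices i, j with M i ≅ M j share one dense set.

record IsShuffleOf {n : ℕ} (M : Fin n → LinearOrder) (Mₐ : ℚ → LinearOrder) : Set where
  field
    covered : ∀ a → ∃[ i ] Mₐ a ≅ M i
    dense   : ∀ i → DenseIn-ℚ (λ a → Mₐ a ≅ M i)

-- The constructor `iso` makes this a family of isomorphism types.

data 𝕄 : Pred LinearOrder (lsuc 0ℓ) where
  one      : 𝟏 ∈ 𝕄
  sum      : ∀ {M N} → M ∈ 𝕄 → N ∈ 𝕄 → M ⊕ N ∈ 𝕄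
  times-ω  : ∀ {M} → M ∈ 𝕄 → M · ω ∈ 𝕄
  times-ω* : ∀ {M} → M ∈ 𝕄 → M · ω ᵒᵖ ∈ 𝕄
  shuffle  : ∀ {n} {M : Fin (suc n) → LinearOrder} {Mₐ : ℚ → LinearOrder} →
             (∀ i → M i ∈ 𝕄) → IsShuffleOf M Mₐ → ∑ η Mₐ ∈ 𝕄
  iso      : ∀ {M N} → M ≅ N → M ∈ 𝕄 → N ∈ 𝕄

-- Monadic second-order formulas with m free element variables and k free set
-- variables, as de Bruijn indices; the remaining connectives and quantifiers
-- are classically definable from these.

infix  8 _≐_ _≺_ _∈̇_
infix  7 ¬̇_
infixr 6 _∧̇_

data Formula (m k : ℕ) : Set where
  _≐_  : Fin m → Fin m → Formula m k
  _≺_  : Fin m → Fin m → Formula m k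
  _∈̇_  : Fin m → Fin k → Formula m k
  ¬̇_   : Formula m k → Formula m k
  _∧̇_  : Formula m k → Formula m k → Formula m k
  ∃ᵉ   : Formula (suc m) k → Formula m k
  ∃ˢ   : Formula m (suc k) → Formula m k

Sentence : Set
Sentence = Formula 0 0

module Semantics (M : LinearOrder) where
  open LinearOrder M using (_<_)

  Sat : ∀ {m k} → Formula m k →
        Vector (Carrier M) m → Vector (Pred (Carrier M) 0ℓ) k → Set₁
  Sat (x ≐ y)  e s = Lift _ (e x ≡ e y)
  Sat (x ≺ y)  e s = Lift _ (e x < e y)
  Sat (x ∈̇ X)  e s = Lift _ (e x ∈ s X)
  Sat (¬̇ φ)    e s = ¬ Sat φ e s
  Sat (φ ∧̇ ψ)  e s = Sat φ e s × Sat ψ e s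
  Sat (∃ᵉ φ)   e s = ∃[ a ] Sat φ (a ∷ e) s
  Sat (∃ˢ φ)   e s = ∃[ A ] Sat φ e (A ∷ s)

infix 4 _⊨_
_⊨_ : LinearOrder → Sentence → Set₁
M ⊨ ψ = Semantics.Sat M ψ [] []

Categorical≤ℵ₀ : Sentence → Set₁
Categorical≤ℵ₀ ψ = ∀ M N → Countable M → Countable N → M ⊨ ψ → N ⊨ ψ → M ≅ N

-- Both directions use the Ehrenfeucht–Fraïssé game for monadic second-order
-- logic: for each n, n-round equivalence has finitely many classes, each class
-- is defined by a sentence, and ordered sums respect equivalence.
--
-- If M ∈ 𝕄, induction on M gives an n such that a countable K which is n-round
-- equivalent to M is isomorphic to M. For a sum, Spoiler plays a colouring of
-- the summands and a set of representatives; the response cuts K into pieces,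
-- over an index order equivalent to the original one. Equivalence pins this
-- index order down, using Cantor's back and forth for shuffles.
--
-- Conversely, every countable K is n-round equivalent to some N ∈ 𝕄, so a
-- categorical ψ of rank n true in K forces K ≅ N. Call an order good if it has
-- such an N, and write a ∼ b if all half-open intervals between a and b are
-- good. Monochromatic paths split convex sets of equivalent points into
-- ω- and ω*-sums of equivalent pieces, so ∼-classes are good. If there were two
-- classes, the classes would be densely ordered, and on some interval the
-- n-round types of the classes would be dense, hence form a shuffle; then the
-- ends of that interval would be ∼-equivalent after all.
module Submission where

open import Defs
open import Axiom.ExcludedMiddle using (ExcludedMiddle)
open import Data.Bool.Base using (Bool; true; false; not; if_then_else_; f<t)
open import Data.Empty using (⊥; ⊥-elim)
open import Data.Fin.Base using (Fin; zero; suc; toℕ; fromℕ<)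
open import Data.Fin.Patterns
import Data.Fin.Properties as Fin
open import Data.Integer.Base as ℤ using (ℤ; -[1+_])
open import Data.List.Base
  using (List; []; _∷_; _++_; map; length; allFin; cartesianProductWith; lookup)
open import Data.List.Membership.Propositional using () renaming (_∈_ to _∈ₗ_)
open import Data.List.Membership.Propositional.Properties
  using (∈-++⁺ˡ; ∈-++⁺ʳ; ∈-++⁻; ∈-map⁺; ∈-map⁻; ∈-allFin; ∈-cartesianProductWith⁺)
open import Data.List.Relation.Unary.Any using (here; there; index)
open import Data.List.Relation.Unary.Any.Properties using (lookup-index)
open import Data.Nat.Base as ℕ using (ℕ; zero; suc; z≤n; s≤s; _⊔_)
import Data.Nat.Properties as ℕ
open import Data.Product using (Σ; ∃; ∃₂; ∃-syntax; _×_; _,_; proj₁; proj₂; swap)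
open import Data.Rational.Base as ℚ using (ℚ; mkℚ)
import Data.Rational.Properties as ℚ
open import Data.Sum.Base using (_⊎_; inj₁; inj₂; [_,_]′)
open import Data.Unit.Base using (⊤; tt)
open import Data.Vec.Functional as Vec using (Vector)
open import Function.Base using (id; _∘_; const; case_of_)
open import Function.Bundles using (_⇔_; mk⇔; Equivalence; mk↣; Injection)
import Function.Properties.Equivalence as ⇔
open import Level using (0ℓ; lift) renaming (suc to lsuc)
open import Relation.Binary.Core using (Rel)
open import Relation.Binary.Definitions using (Trichotomous; tri<; tri≈; tri>)
open import Relation.Binary.Morphism.Structures using (IsOrderIsomorphism)
open import Relation.Binary.PropositionalEquality
  using (_≡_; refl; sym; trans; cong; subst; subst₂; isEquivalence)
open import Relation.Binary.Structures using (IsStrictTotalOrder)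
open import Relation.Binary.Structures.Biased using (isStrictTotalOrderᶜ)
open import Relation.Nullary using (¬_; Dec; yes; no; recompute; contradiction)
open import Relation.Nullary.Decidable using (True; toWitness; fromWitness; decidable-stable)
open import Relation.Unary using (Pred; _∈_; _⊆_; _∪_; U; ｛_｝)

open Equivalence using (to; from)


-- Linear orders

-- Positions of the game carry sets only, and Duplicator's replies are data, so strategies on
-- infinitely many summands combine into one on the sum without a choice principle. This handles
-- sums that are given as sums. The obstacle is the converse: an order equivalent to a sum is not
-- presented as one, and a set of representatives does not show where one summand ends and the next
-- begins. The extra colouring makes "same summand" first-order definable, after which further
-- rounds can transfer a labelling of the index order and compare a single piece with a single
-- summand.
--
-- In the other direction half-open intervals are used because adjacent ones concatenate exactly.
-- The relation `∼` quantifies over all intervals between two points, and not just over the outer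
-- one, so that it passes to points in between and its classes are convex.

module Order (M : LinearOrder) where
  open LinearOrder M public using (_<_; inhabited)
  open IsStrictTotalOrder (LinearOrder.isStrictTotalOrder M) public
    using (irrefl; asym; compare) renaming (trans to <-trans)

  infix 4 _≤_
  _≤_ : Rel (Carrier M) 0ℓ
  x ≤ y = ¬ y < x

  <-≤-trans : ∀ {x y z} → x < y → y ≤ z → x < z
  <-≤-trans {x} {y} {z} x<y y≤z with compare x z
  ... | tri< x<z _ _  = x<z
  ... | tri≈ _ refl _ = contradiction x<y y≤z
  ... | tri> _ _ z<x  = contradiction (<-trans z<x x<y) y≤z

  ≤-<-trans : ∀ {x y z} → x ≤ y → y < z → x < z
  ≤-<-trans {x} {y} {z} x≤y y<z with compare x z
  ... | tri< x<z _ _  = x<z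
  ... | tri≈ _ refl _ = contradiction y<z x≤y
  ... | tri> _ _ z<x  = contradiction (<-trans y<z z<x) x≤y

  ≤-trans : ∀ {x y z} → x ≤ y → y ≤ z → x ≤ z
  ≤-trans x≤y y≤z z<x = y≤z (<-≤-trans z<x x≤y)

  ≤-antisym : ∀ {x y} → x ≤ y → y ≤ x → x ≡ y
  ≤-antisym {x} {y} x≤y y≤x with compare x y
  ... | tri< x<y _ _ = contradiction x<y y≤x
  ... | tri≈ _ x≡y _ = x≡y
  ... | tri> _ _ y<x = contradiction y<x x≤y

  <⇒≤ : ∀ {x y} → x < y → x ≤ y
  <⇒≤ = asym

  ≤-refl : ∀ {x} → x ≤ x
  ≤-refl = irrefl refl

  <⊎≥ : ∀ x y → x < y ⊎ y ≤ x
  <⊎≥ x y with compare x y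
  ... | tri< x<y _ _ = inj₁ x<y
  ... | tri≈ x≮y _ _ = inj₂ x≮y
  ... | tri> x≮y _ _ = inj₂ x≮y

  -- The closed interval with its ends in either order, put negatively so that `x` and `y` need not
  -- be compared and `betweenᶠ` can express it with the atoms `<̇`.
  Between : (x y : Carrier M) → Pred (Carrier M) 0ℓ
  Between x y z = ¬ (z < x × z < y) × ¬ (x < z × y < z)

  between⁺ : ∀ {x y z} → x ≤ z → z ≤ y → z ∈ Between x y
  between⁺ x≤z z≤y = x≤z ∘ proj₁ , z≤y ∘ proj₂

  between-sym : ∀ {x y} → Between x y ⊆ Between y x
  between-sym (p , q) = (λ (a , b) → p (b , a)) , λ (a , b) → q (b , a)

  between-≤ : ∀ {x y z} → z ∈ Between x y → x ≤ y → x ≤ z × z ≤ y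
  between-≤ (p , q) x≤y =
    (λ z<x → p (z<x , <-≤-trans z<x x≤y)) , λ y<z → q (≤-<-trans x≤y y<z , y<z)

-- By trichotomy a strictly monotone map between total orders is injective and reflects the order.
≅-intro : ∀ {M N} (f : Carrier M → Carrier N) →
          (∀ {x y} → Order._<_ M x y → Order._<_ N (f x) (f y)) →
          (∀ y → ∃[ x ] f x ≡ y) → M ≅ N
≅-intro {M} {N} f mono surj = f , record
  { isOrderMonomorphism = record
    { isOrderHomomorphism = record { cong = cong f ; mono = mono }
    ; injective = injective
    ; cancel = cancel
    }
  ; surjective = λ y → proj₁ (surj y) , λ { refl → proj₂ (surj y) }
  }
  where
  module M = Order M
  module N = Order N

  injective : ∀ {x y} → f x ≡ f y → x ≡ y
  injective {x} {y} eq with M.compare x y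
  ... | tri< x<y _ _ = contradiction (mono x<y) (N.irrefl eq)
  ... | tri≈ _ x≡y _ = x≡y
  ... | tri> _ _ y<x = contradiction (mono y<x) (N.irrefl (sym eq))

  cancel : ∀ {x y} → f x N.< f y → x M.< y
  cancel {x} {y} p with M.compare x y
  ... | tri< x<y _ _  = x<y
  ... | tri≈ _ refl _ = contradiction p (N.irrefl refl)
  ... | tri> _ _ y<x  = contradiction p (N.asym (mono y<x))

module Iso {M N : LinearOrder} (M≅N : M ≅ N) where
  private
    module M = Order M
    module N = Order N

  fun : Carrier M → Carrier N
  fun = proj₁ M≅N

  open IsOrderIsomorphism (proj₂ M≅N) public using (mono; cancel; injective; surjective)

  inv : Carrier N → Carrier M
  inv y = proj₁ (surjective y)

  fun-inv : ∀ y → fun (inv y) ≡ y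
  fun-inv y = proj₂ (surjective y) refl

  inv-fun : ∀ x → inv (fun x) ≡ x
  inv-fun x = injective (fun-inv (fun x))

  inv-mono : ∀ {x y} → x N.< y → inv x M.< inv y
  inv-mono {x} {y} x<y = cancel (subst₂ N._<_ (sym (fun-inv x)) (sym (fun-inv y)) x<y)

≅-refl : ∀ {M} → M ≅ M
≅-refl {M} = ≅-intro {M} {M} id id λ y → y , refl

≅-sym : ∀ {M N} → M ≅ N → N ≅ M
≅-sym {M} {N} M≅N = ≅-intro {N} {M} inv inv-mono λ x → fun x , inv-fun x
  where open Iso {M} {N} M≅N

≅-trans : ∀ {L M N} → L ≅ M → M ≅ N → L ≅ N
≅-trans {L} {M} {N} L≅M M≅N = ≅-intro {L} {N} (G.fun ∘ F.fun) (G.mono ∘ F.mono) λ z →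
  F.inv (G.inv z) , trans (cong G.fun (F.fun-inv (G.inv z))) (G.fun-inv z)
  where
  module F = Iso {L} {M} L≅M
  module G = Iso {M} {N} M≅N

op-≅ : ∀ {M N} → M ≅ N → M ᵒᵖ ≅ N ᵒᵖ
op-≅ {M} {N} M≅N = ≅-intro {M ᵒᵖ} {N ᵒᵖ} fun mono λ y → inv y , fun-inv y
  where open Iso {M} {N} M≅N

-- The proof component is irrelevant, so elements are equal as soon as their
-- underlying points are.
record Sub {A : Set} (P : Pred A 0ℓ) : Set where
  constructor _∣_
  field
    elem   : A
    .holds : P elem
open Sub public using (elem)

Sub-≡ : {A : Set} {P : Pred A 0ℓ} {x y : Sub P} → elem x ≡ elem y → x ≡ y
Sub-≡ refl = refl

infix 8 _↾_
_↾_ : (M : LinearOrder) {P : Pred (Carrier M) 0ℓ} → ∃ P → LinearOrder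
_↾_ M {P} (a , Pa) = record
  { Carrier            = Sub P
  ; _<_                = λ x y → elem x < elem y
  ; isStrictTotalOrder = isStrictTotalOrderᶜ record
      { isEquivalence = isEquivalence
      ; trans         = <-trans
      ; compare       = Sub-compare
      }
  ; inhabited          = a ∣ Pa
  }
  where
  open Order M
  Sub-compare : Trichotomous _≡_ (λ (x y : Sub P) → elem x < elem y)
  Sub-compare (x ∣ p) (y ∣ q) with compare x y
  ... | tri< x<y x≢y x≯y  = tri< x<y (x≢y ∘ cong elem) x≯y
  ... | tri≈ x≮y refl x≯y = tri≈ x≮y refl x≯y
  ... | tri> x≮y x≢y x>y  = tri> x≮y (x≢y ∘ cong elem) x>y

∑-cong : ∀ {I J M N} (I≅J : I ≅ J) → (∀ i → M i ≅ N (Iso.fun {I} {J} I≅J i)) → ∑ I M ≅ ∑ J N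
∑-cong {I} {J} {M} {N} I≅J M≅N = ≅-intro {∑ I M} {∑ J N} (λ (i , x) → fun i , F.fun i x) mono′ surj
  where
  open Iso {I} {J} I≅J
  module F i = Iso {M i} {N (fun i)} (M≅N i)

  mono′ : ∀ {a b} → Order._<_ (∑ I M) a b →
          Order._<_ (∑ J N) (fun (proj₁ a) , F.fun _ (proj₂ a)) (fun (proj₁ b) , F.fun _ (proj₂ b))
  mono′ (OrderedSum.across p) = OrderedSum.across (mono p)
  mono′ (OrderedSum.within p) = OrderedSum.within (F.mono _ p)

  surj : ∀ b → ∃[ a ] (fun (proj₁ a) , F.fun (proj₁ a) (proj₂ a)) ≡ b
  surj (j , y) with inv j | fun-inv j
  ... | i | refl = (i , F.inv i y) , cong (fun i ,_) (F.fun-inv i y)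

op-· : ∀ M I → (M · I) ᵒᵖ ≅ M ᵒᵖ · I ᵒᵖ
op-· M I = ≅-intro {(M · I) ᵒᵖ} {M ᵒᵖ · I ᵒᵖ} id mono λ y → y , refl
  where
  mono : ∀ {a b} → Order._<_ ((M · I) ᵒᵖ) a b → Order._<_ (M ᵒᵖ · I ᵒᵖ) a b
  mono (OrderedSum.across p) = OrderedSum.across p
  mono (OrderedSum.within p) = OrderedSum.within p

sub-countable : ∀ M {P : Pred (Carrier M) 0ℓ} (ne : ∃ P) → Countable M → Countable (M ↾ ne)
sub-countable M ne M↣ℕ = mk↣ {to = Injection.to M↣ℕ ∘ elem} (Sub-≡ ∘ Injection.injective M↣ℕ)

≅-countable : ∀ {M N} → M ≅ N → Countable M → Countable N
≅-countable {M} {N} M≅N M↣ℕ = mk↣ {to = λ y → Injection.to M↣ℕ (inv y)} λ {x} {y} eq →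
  trans (sym (fun-inv x)) (trans (cong fun (Injection.injective M↣ℕ eq)) (fun-inv y))
  where open Iso {M} {N} M≅N

module Restriction (em : ∀ ℓ → ExcludedMiddle ℓ) (M : LinearOrder) where
  open Order M

  -- The irrelevant proof is recovered by deciding `P` with excluded middle.
  member : {P : Pred (Carrier M) 0ℓ} (x : Sub P) → P (elem x)
  member (x ∣ p) = recompute (em 0ℓ) p

  ↾-cong : {P Q : Pred (Carrier M) 0ℓ} (p : ∃ P) (q : ∃ Q) → P ⊆ Q → Q ⊆ P → M ↾ p ≅ M ↾ q
  ↾-cong p q P⊆Q Q⊆P =
    ≅-intro {M ↾ p} {M ↾ q} (λ x → elem x ∣ P⊆Q (member x)) id
      λ y → (elem y ∣ Q⊆P (member y)) , refl

  ↾-U : {P : Pred (Carrier M) 0ℓ} (p : ∃ P) → (∀ x → P x) → M ↾ p ≅ M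
  ↾-U p all = ≅-intro {M ↾ p} {M} elem id λ x → (x ∣ all x) , refl

  -- Disjointness of the pieces comes from `ordered`: a point common to two of them would lie below
  -- itself.
  glue : ∀ I (T : Carrier I → Pred (Carrier M) 0ℓ) (t : ∀ i → ∃ (T i))
         {S : Pred (Carrier M) 0ℓ} (s : ∃ S) →
         (∀ i → T i ⊆ S) → (∀ {x} → S x → ∃[ i ] T i x) →
         (∀ {i j x y} → Order._<_ I i j → T i x → T j y → x < y) →
         ∑ I (λ i → M ↾ t i) ≅ M ↾ s
  glue I T t s T⊆S cover ordered =
    ≅-intro {∑ I (λ i → M ↾ t i)} {M ↾ s} include mono surj
    where
    include : Carrier (∑ I (λ i → M ↾ t i)) → Sub _
    include (i , x) = elem x ∣ T⊆S i (member {T i} x)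

    mono : ∀ {a b} → Order._<_ (∑ I (λ i → M ↾ t i)) a b → elem (proj₂ a) < elem (proj₂ b)
    mono (OrderedSum.across {x = x} {y} i<j) = ordered i<j (member {T _} x) (member {T _} y)
    mono (OrderedSum.within p)   = p

    surj : ∀ y → ∃[ a ] include a ≡ y
    surj y = let i , Tiy = cover (member y) in (i , elem y ∣ Tiy) , refl

-- Ehrenfeucht–Fraïssé games

record Position (p : ℕ) : Set₁ where
  constructor _⊢_
  field
    order : LinearOrder
    sets  : Vector (Pred (Carrier order) 0ℓ) p
open Position public

infix  4 _⊢_
infixl 6 _◂_
_◂_ : ∀ {p} (P : Position p) → Pred (Carrier (order P)) 0ℓ → Position (suc p)
P ◂ X = order P ⊢ X Vec.∷ sets P

-- On singletons `⊆̇` is equality or membership and `<̇` is the order. In a sum, `<̇` across two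
-- summands depends only on which sets are nonempty in each, which is what `ne` records.
data Atom (p : ℕ) : Set where
  _⊆̇_ _<̇_ : Fin p → Fin p → Atom p
  ne      : Fin p → Atom p

Holds : ∀ {p} → Position p → Atom p → Set
Holds P (i ⊆̇ j) = ∀ x → sets P i x → sets P j x
Holds P (i <̇ j) = ∃₂ λ x y → sets P i x × sets P j y × Order._<_ (order P) x y
Holds P (ne i)  = ∃ (sets P i)

SameAtoms : ∀ {p} → Position p → Position p → Set
SameAtoms P Q = ∀ a → Holds P a ⇔ Holds Q a

-- Duplicator wins the n-round Ehrenfeucht–Fraïssé game in which only sets are
-- played; elements are played as singletons.
data _≈[_]_ {p : ℕ} : Position p → ℕ → Position p → Set₁ where
  stop : ∀ {P Q} → SameAtoms P Q → P ≈[ 0 ] Q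
  move : ∀ {n P Q} → SameAtoms P Q →
         (∀ X → ∃[ Y ] P ◂ X ≈[ n ] Q ◂ Y) →
         (∀ Y → ∃[ X ] P ◂ X ≈[ n ] Q ◂ Y) →
         P ≈[ suc n ] Q

infix 3 _≈[_]_

private
  variable
    p n : ℕ
    P Q R : Position p

≈⇒atoms : P ≈[ n ] Q → SameAtoms P Q
≈⇒atoms (stop a)     = a
≈⇒atoms (move a _ _) = a

≈-forth : P ≈[ suc n ] Q → ∀ X → ∃[ Y ] P ◂ X ≈[ n ] Q ◂ Y
≈-forth (move _ f _) = f

≈-back : P ≈[ suc n ] Q → ∀ Y → ∃[ X ] P ◂ X ≈[ n ] Q ◂ Y
≈-back (move _ _ b) = b

≈-sym : P ≈[ n ] Q → Q ≈[ n ] P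
≈-sym (stop a)     = stop (⇔.sym ∘ a)
≈-sym (move a f b) = move (⇔.sym ∘ a)
  (λ Y → let X , e = b Y in X , ≈-sym e)
  (λ X → let Y , e = f X in Y , ≈-sym e)

≈-trans : P ≈[ n ] Q → Q ≈[ n ] R → P ≈[ n ] R
≈-trans (stop a)     (stop a′)       = stop λ x → ⇔.trans (a x) (a′ x)
≈-trans (move a f b) (move a′ f′ b′) = move (λ x → ⇔.trans (a x) (a′ x))
  (λ X → let Y , e = f X ; Z , e′ = f′ Y in Z , ≈-trans e e′)
  (λ Z → let Y , e′ = b′ Z ; X , e = b Y in X , ≈-trans e e′)

≈-mono : ∀ {m n} {P Q : Position p} → m ℕ.≤ n → P ≈[ n ] Q → P ≈[ m ] Q
≈-mono z≤n       e            = stop (≈⇒atoms e)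
≈-mono (s≤s m≤n) (move a f b) = move a
  (λ X → let Y , e = f X in Y , ≈-mono m≤n e)
  (λ Y → let X , e = b Y in X , ≈-mono m≤n e)

≈-iso : ∀ n {M N} (M≅N : M ≅ N) {s : Vector (Pred (Carrier M) 0ℓ) p} {t : Vector (Pred (Carrier N) 0ℓ) p} →
        (∀ i x → s i x ⇔ t i (Iso.fun {M} {N} M≅N x)) → M ⊢ s ≈[ n ] N ⊢ t
≈-iso {p} n {M} {N} M≅N {s} {t} s⇔t = go n
  where
  open Iso {M} {N} M≅N

  pull : ∀ i y → t i y → s i (inv y)
  pull i y tiy = from (s⇔t i (inv y)) (subst (t i) (sym (fun-inv y)) tiy)

  atoms : SameAtoms (M ⊢ s) (N ⊢ t)
  atoms (i ⊆̇ j) = mk⇔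
    (λ s⊆s y tiy → subst (t j) (fun-inv y) (to (s⇔t j (inv y)) (s⊆s (inv y) (pull i y tiy))))
    (λ t⊆t x six → from (s⇔t j x) (t⊆t (fun x) (to (s⇔t i x) six)))
  atoms (i <̇ j) = mk⇔
    (λ (x , y , six , sjy , x<y) → fun x , fun y , to (s⇔t i x) six , to (s⇔t j y) sjy , mono x<y)
    (λ (x , y , tix , tjy , x<y) → inv x , inv y , pull i x tix , pull j y tjy , inv-mono x<y)
  atoms (ne i)  = mk⇔
    (λ (x , six) → fun x , to (s⇔t i x) six)
    (λ (y , tiy) → inv y , pull i y tiy)

  go : ∀ n → M ⊢ s ≈[ n ] N ⊢ t
  go zero    = stop atoms
  go (suc n) = move atoms
    (λ X → X ∘ inv , ≈-iso n M≅N λ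
      { zero x    → mk⇔ (subst X (sym (inv-fun x))) (subst X (inv-fun x))
      ; (suc i) x → s⇔t i x })
    (λ Y → Y ∘ fun , ≈-iso n M≅N λ { zero x → ⇔.refl ; (suc i) x → s⇔t i x })

≈-resp : ∀ n M {s t : Vector (Pred (Carrier M) 0ℓ) p} → (∀ i x → s i x ⇔ t i x) → M ⊢ s ≈[ n ] M ⊢ t
≈-resp n M = ≈-iso n (≅-refl {M})

≈-refl : P ≈[ n ] P
≈-refl {P = P} = ≈-resp _ (order P) λ _ _ → ⇔.refl

fibre : ∀ {I M} → Vector (Pred (Carrier (∑ I M)) 0ℓ) p → (i : Carrier I) → Vector (Pred (Carrier (M i)) 0ℓ) p
fibre s i j x = s j (i , x)

-- A set played in the sum is a family of sets, one in each summand; Duplicator answers each by the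
-- strategy of that summand and keeps the index fixed.
≈-∑ : ∀ {p n} I {M N : Carrier I → LinearOrder}
      {s : Vector (Pred (Carrier (∑ I M)) 0ℓ) p} {t : Vector (Pred (Carrier (∑ I N)) 0ℓ) p} →
      (∀ i → M i ⊢ fibre {I = I} {M} s i ≈[ n ] N i ⊢ fibre {I = I} {N} t i) →
      ∑ I M ⊢ s ≈[ n ] ∑ I N ⊢ t
≈-∑ {p} {n} I {M} {N} {s} {t} e = go n e
  where
  open OrderedSum

  atoms : SameAtoms (∑ I M ⊢ s) (∑ I N ⊢ t)
  atoms (j ⊆̇ k) = mk⇔
    (λ s⊆s (i , y) → to (≈⇒atoms (e i) (j ⊆̇ k)) (λ x → s⊆s (i , x)) y)
    (λ t⊆t (i , x) → from (≈⇒atoms (e i) (j ⊆̇ k)) (λ y → t⊆t (i , y)) x)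
  atoms (j <̇ k) = mk⇔ forth back
    where
    forth : Holds (∑ I M ⊢ s) (j <̇ k) → Holds (∑ I N ⊢ t) (j <̇ k)
    forth ((i , x) , (i′ , x′) , sx , sx′ , across i<i′) =
      let y , ty = to (≈⇒atoms (e i) (ne j)) (x , sx)
          y′ , ty′ = to (≈⇒atoms (e i′) (ne k)) (x′ , sx′)
      in (i , y) , (i′ , y′) , ty , ty′ , across i<i′
    forth ((i , x) , (_ , x′) , sx , sx′ , within x<x′) =
      let y , y′ , ty , ty′ , y<y′ = to (≈⇒atoms (e i) (j <̇ k)) (x , x′ , sx , sx′ , x<x′)
      in (i , y) , (i , y′) , ty , ty′ , within y<y′
    back : Holds (∑ I N ⊢ t) (j <̇ k) → Holds (∑ I M ⊢ s) (j <̇ k)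
    back ((i , y) , (i′ , y′) , ty , ty′ , across i<i′) =
      let x , sx = from (≈⇒atoms (e i) (ne j)) (y , ty)
          x′ , sx′ = from (≈⇒atoms (e i′) (ne k)) (y′ , ty′)
      in (i , x) , (i′ , x′) , sx , sx′ , across i<i′
    back ((i , y) , (_ , y′) , ty , ty′ , within y<y′) =
      let x , x′ , sx , sx′ , x<x′ = from (≈⇒atoms (e i) (j <̇ k)) (y , y′ , ty , ty′ , y<y′)
      in (i , x) , (i , x′) , sx , sx′ , within x<x′
  atoms (ne j)  = mk⇔
    (λ ((i , x) , sx) → let y , ty = to (≈⇒atoms (e i) (ne j)) (x , sx) in (i , y) , ty)
    (λ ((i , y) , ty) → let x , sx = from (≈⇒atoms (e i) (ne j)) (y , ty) in (i , x) , sx)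

  -- The fibre of an extended list of sets agrees with the extended fibre only pointwise, hence the
  -- detour through `≈-resp`.
  extend : ∀ {n} {X : Pred (Carrier (∑ I M)) 0ℓ} {Y : Pred (Carrier (∑ I N)) 0ℓ} →
           (∀ i → M i ⊢ (λ x → X (i , x)) Vec.∷ fibre {I = I} {M} s i ≈[ n ]
                  N i ⊢ (λ y → Y (i , y)) Vec.∷ fibre {I = I} {N} t i) →
           ∑ I M ⊢ X Vec.∷ s ≈[ n ] ∑ I N ⊢ Y Vec.∷ t
  extend {n} e = ≈-∑ I λ i →
    ≈-trans (≈-resp n (M i) λ { zero _ → ⇔.refl ; (suc _) _ → ⇔.refl })
    (≈-trans (e i) (≈-resp n (N i) λ { zero _ → ⇔.refl ; (suc _) _ → ⇔.refl }))

  go : ∀ n → (∀ i → M i ⊢ fibre {I = I} {M} s i ≈[ n ] N i ⊢ fibre {I = I} {N} t i) →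
       ∑ I M ⊢ s ≈[ n ] ∑ I N ⊢ t
  go zero    _ = stop atoms
  go (suc n) e = move atoms
    (λ X → (λ (i , y) → proj₁ (≈-forth (e i) (λ x → X (i , x))) y) ,
           extend λ i → proj₂ (≈-forth (e i) (λ x → X (i , x))))
    (λ Y → (λ (i , x) → proj₁ (≈-back (e i) (λ y → Y (i , y))) x) ,
           extend λ i → proj₂ (≈-back (e i) (λ y → Y (i , y))))

≈-op : P ≈[ n ] Q → order P ᵒᵖ ⊢ sets P ≈[ n ] order Q ᵒᵖ ⊢ sets Q
≈-op {P = P} {Q = Q} e = go e
  where
  atoms : SameAtoms P Q → SameAtoms (order P ᵒᵖ ⊢ sets P) (order Q ᵒᵖ ⊢ sets Q)
  atoms a (i ⊆̇ j) = a (i ⊆̇ j)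
  atoms a (ne i)  = a (ne i)
  atoms a (i <̇ j) = mk⇔
    (λ (x , y , sx , sy , y<x) →
      let y , x , ty , tx , p = to (a (j <̇ i)) (y , x , sy , sx , y<x) in x , y , tx , ty , p)
    (λ (x , y , sx , sy , y<x) →
      let y , x , ty , tx , p = from (a (j <̇ i)) (y , x , sy , sx , y<x) in x , y , tx , ty , p)

  go : ∀ {n} → P ≈[ n ] Q → order P ᵒᵖ ⊢ sets P ≈[ n ] order Q ᵒᵖ ⊢ sets Q
  go (stop a)     = stop (atoms a)
  go (move a f b) = move (atoms a)
    (λ X → let Y , e = f X in Y , ≈-op e)
    (λ Y → let X , e = b Y in X , ≈-op e)

-- The reply to a singleton is again a singleton: `ne` makes it inhabited, and two distinct elements
-- would make `zero <̇ zero` true.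
≈-point : P ≈[ suc n ] Q → ∀ b → ∃[ a ] P ◂ ｛ a ｝ ≈[ n ] Q ◂ ｛ b ｝
≈-point {P = P} {n = n} {Q = Q} e b = a , ≈-trans (≈-resp n (order P) same) e′
  where
  module M = Order (order P)
  X = proj₁ (≈-back e ｛ b ｝)
  e′ = proj₂ (≈-back e ｛ b ｝)

  inX : ∃ X
  inX = from (≈⇒atoms e′ (ne zero)) (b , refl)
  a = proj₁ inX

  atMostOne : ∀ {x y} → X x → X y → x M.≤ y
  atMostOne Xx Xy y<x with to (≈⇒atoms e′ (zero <̇ zero)) (_ , _ , Xy , Xx , y<x)
  ... | _ , _ , refl , refl , b<b = Order.irrefl (order Q) refl b<b

  same : ∀ i x → (｛ a ｝ Vec.∷ sets P) i x ⇔ (X Vec.∷ sets P) i x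
  same zero    x = mk⇔ (λ { refl → proj₂ inX })
                       λ Xx → M.≤-antisym (atMostOne (proj₂ inX) Xx) (atMostOne Xx (proj₂ inX))
  same (suc i) x = ⇔.refl

module Relativisation (em : ∀ ℓ → ExcludedMiddle ℓ) where
  -- A move inside the restriction is played in the full game as a subset of the set `c`. The atom
  -- `⊆̇` forces the reply into the counterpart of `c`, so it is a legal reply in the restriction.
  ≈-↾ : ∀ {p q n} {P Q : Position p} → P ≈[ n ] Q →
        (c : Fin p) (ι : Fin q → Fin p) → (∀ j → sets P (ι j) ⊆ sets P c) →
        (x₀ : ∃ (sets P c)) (y₀ : ∃ (sets Q c)) →
        order P ↾ x₀ ⊢ (λ j x → sets P (ι j) (elem x)) ≈[ n ] order Q ↾ y₀ ⊢ (λ j y → sets Q (ι j) (elem y))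
  ≈-↾ {p} {q} {n} {P} {Q} e c ι ι⊆c x₀ y₀ = go e
    where
    module P = Restriction em (order P)
    module Q = Restriction em (order Q)

    ι⊆c′ : ∀ j → sets Q (ι j) ⊆ sets Q c
    ι⊆c′ j {y} = to (≈⇒atoms e (ι j ⊆̇ c)) (λ x → ι⊆c j) y

    P′ = order P ↾ x₀ ⊢ λ j x → sets P (ι j) (elem x)
    Q′ = order Q ↾ y₀ ⊢ λ j y → sets Q (ι j) (elem y)

    atoms : SameAtoms P′ Q′
    atoms (i ⊆̇ j) = mk⇔
      (λ s⊆s y tiy → to (≈⇒atoms e (ι i ⊆̇ ι j)) (λ x six → s⊆s (x ∣ ι⊆c i six) six) (elem y) tiy)
      (λ t⊆t x six → from (≈⇒atoms e (ι i ⊆̇ ι j)) (λ y tiy → t⊆t (y ∣ ι⊆c′ i tiy) tiy) (elem x) six)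
    atoms (i <̇ j) = mk⇔
      (λ (x , x′ , six , sjx′ , x<x′) →
        let y , y′ , tiy , tjy′ , y<y′ = to (≈⇒atoms e (ι i <̇ ι j)) (elem x , elem x′ , six , sjx′ , x<x′)
        in (y ∣ ι⊆c′ i tiy) , (y′ ∣ ι⊆c′ j tjy′) , tiy , tjy′ , y<y′)
      (λ (y , y′ , tiy , tjy′ , y<y′) →
        let x , x′ , six , sjx′ , x<x′ = from (≈⇒atoms e (ι i <̇ ι j)) (elem y , elem y′ , tiy , tjy′ , y<y′)
        in (x ∣ ι⊆c i six) , (x′ ∣ ι⊆c j sjx′) , six , sjx′ , x<x′)
    atoms (ne i)  = mk⇔
      (λ (x , six) → let y , tiy = to (≈⇒atoms e (ne (ι i))) (elem x , six) in (y ∣ ι⊆c′ i tiy) , tiy)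
      (λ (y , tiy) → let x , six = from (≈⇒atoms e (ne (ι i))) (elem y , tiy) in (x ∣ ι⊆c i six) , six)

    ι′ : Fin (suc q) → Fin (suc p)
    ι′ = zero Vec.∷ (suc ∘ ι)

    go : ∀ {n} → P ≈[ n ] Q → P′ ≈[ n ] Q′
    go (stop _) = stop atoms
    go {suc n} (move _ f b) = move atoms forth back
      where
      forth : ∀ X → ∃[ Y ] P′ ◂ X ≈[ n ] Q′ ◂ Y
      forth X = (λ y → Y (elem y)) ,
        ≈-trans (≈-resp n (order P ↾ x₀) λ
                  { zero x → mk⇔ (P.member x ,_) proj₂ ; (suc _) _ → ⇔.refl })
        (≈-trans (≈-↾ (proj₂ (f X̂)) (suc c) ι′ (λ { zero → proj₁ ; (suc j) → ι⊆c j }) x₀ y₀)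
                 (≈-resp n (order Q ↾ y₀) λ { zero _ → ⇔.refl ; (suc _) _ → ⇔.refl }))
        where
        X̂ : Pred (Carrier (order P)) 0ℓ
        X̂ x = Σ (sets P c x) λ h → X (x ∣ h)
        Y = proj₁ (f X̂)

      back : ∀ Y → ∃[ X ] P′ ◂ X ≈[ n ] Q′ ◂ Y
      back Y = (λ x → X (elem x)) ,
        ≈-trans (≈-resp n (order P ↾ x₀) λ { zero _ → ⇔.refl ; (suc _) _ → ⇔.refl })
        (≈-trans (≈-↾ e′ (suc c) ι′ (λ { zero → X⊆c ; (suc j) → ι⊆c j }) x₀ y₀)
                 (≈-resp n (order Q ↾ y₀) λ
                  { zero y → mk⇔ proj₂ (Q.member y ,_) ; (suc _) _ → ⇔.refl }))
        where
        Ŷ : Pred (Carrier (order Q)) 0ℓ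
        Ŷ y = Σ (sets Q c y) λ h → Y (y ∣ h)
        X = proj₁ (b Ŷ)
        e′ = proj₂ (b Ŷ)
        X⊆c : X ⊆ sets P c
        X⊆c {x} = from (≈⇒atoms e′ (zero ⊆̇ suc c)) (λ _ → proj₁) x

-- Types and their characteristic formulas

⟦_⟧ : LinearOrder → Position 0
⟦ M ⟧ = M ⊢ Vec.[]

_⊩_ : Position p → Formula 0 p → Set₁
P ⊩ φ = Semantics.Sat (order P) φ Vec.[] (sets P)

infix 4 _⊩_

atomFormula : Atom p → Formula 0 p
atomFormula (i ⊆̇ j) = ¬̇ ∃ᵉ (zero ∈̇ i ∧̇ ¬̇ zero ∈̇ j)
atomFormula (i <̇ j) = ∃ᵉ (∃ᵉ (suc zero ∈̇ i ∧̇ zero ∈̇ j ∧̇ suc zero ≺ zero))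
atomFormula (ne i)  = ∃ᵉ (zero ∈̇ i)

atoms : ∀ p → List (Atom p)
atoms p = cartesianProductWith _⊆̇_ (allFin p) (allFin p) ++
          cartesianProductWith _<̇_ (allFin p) (allFin p) ++ map ne (allFin p)

∈-atoms : (a : Atom p) → a ∈ₗ atoms p
∈-atoms (i ⊆̇ j) = ∈-++⁺ˡ (∈-cartesianProductWith⁺ _⊆̇_ (∈-allFin i) (∈-allFin j))
∈-atoms {p} (i <̇ j) = ∈-++⁺ʳ (cartesianProductWith _⊆̇_ (allFin p) (allFin p))
  (∈-++⁺ˡ (∈-cartesianProductWith⁺ _<̇_ (∈-allFin i) (∈-allFin j)))
∈-atoms {p} (ne i)  = ∈-++⁺ʳ (cartesianProductWith _⊆̇_ (allFin p) (allFin p))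
  (∈-++⁺ʳ (cartesianProductWith _<̇_ (allFin p) (allFin p)) (∈-map⁺ ne (∈-allFin i)))

-- Valid because structures are nonempty.
⊤̇ : Formula 0 p
⊤̇ = ∃ᵉ (zero ≐ zero)

completeTypes : List (Formula 0 p) → List (Formula 0 p)
completeTypes []      = ⊤̇ ∷ []
completeTypes (φ ∷ Φ) = map (φ ∧̇_) (completeTypes Φ) ++ map (¬̇ φ ∧̇_) (completeTypes Φ)

-- A finite list whose truth values determine the n-round type: the atoms, and for each conceivable
-- type with one more set and one round fewer, whether some set realises it.
hintikka : (n p : ℕ) → List (Formula 0 p)
hintikka zero    p = map atomFormula (atoms p)
hintikka (suc n) p = map atomFormula (atoms p) ++ map ∃ˢ (completeTypes (hintikka n (suc p)))

Agree : List (Formula 0 p) → Position p → Position p → Set₁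
Agree Φ P Q = ∀ {φ} → φ ∈ₗ Φ → P ⊩ φ ⇔ Q ⊩ φ

completeTypes-sound : ∀ (Φ : List (Formula 0 p)) {χ} → χ ∈ₗ completeTypes Φ →
                      P ⊩ χ → Q ⊩ χ → Agree Φ P Q
completeTypes-sound (ψ ∷ Φ) χ∈ Pχ Qχ φ∈ with ∈-++⁻ (map (ψ ∧̇_) (completeTypes Φ)) χ∈
completeTypes-sound (ψ ∷ Φ) χ∈ Pχ Qχ φ∈ | inj₁ χ∈₁ with ∈-map⁻ (ψ ∧̇_) χ∈₁
completeTypes-sound (ψ ∷ Φ) χ∈ (Pψ , _) (Qψ , _) (here refl) | inj₁ _ | _ , _ , refl = mk⇔ (const Qψ) (const Pψ)
completeTypes-sound (ψ ∷ Φ) χ∈ (_ , Pχ) (_ , Qχ) (there φ∈)  | inj₁ _ | _ , χ′∈ , refl =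
  completeTypes-sound Φ χ′∈ Pχ Qχ φ∈
completeTypes-sound (ψ ∷ Φ) χ∈ Pχ Qχ φ∈ | inj₂ χ∈₂ with ∈-map⁻ (¬̇ ψ ∧̇_) χ∈₂
completeTypes-sound (ψ ∷ Φ) χ∈ (P¬ψ , _) (Q¬ψ , _) (here refl) | inj₂ _ | _ , _ , refl =
  mk⇔ (λ Pψ → contradiction Pψ P¬ψ) (λ Qψ → contradiction Qψ Q¬ψ)
completeTypes-sound (ψ ∷ Φ) χ∈ (_ , Pχ) (_ , Qχ) (there φ∈) | inj₂ _ | _ , χ′∈ , refl =
  completeTypes-sound Φ χ′∈ Pχ Qχ φ∈

rank : ∀ {m k} → Formula m k → ℕ
rank (_ ≐ _)  = 0
rank (_ ≺ _)  = 0
rank (_ ∈̇ _)  = 0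
rank (¬̇ φ)    = rank φ
rank (φ ∧̇ ψ)  = rank φ ⊔ rank ψ
rank (∃ᵉ φ)   = suc (rank φ)
rank (∃ˢ φ)   = suc (rank φ)

-- Formulas keep element and set variables apart while positions have sets only; `ρ` and `σ` tell
-- which set of the position stands for which variable.
record Represents {m k p} (P : Position p) (ρ : Fin m → Fin p) (σ : Fin k → Fin p)
                  (e : Vector (Carrier (order P)) m) (s : Vector (Pred (Carrier (order P)) 0ℓ) k) : Set where
  field
    elements : ∀ i x → sets P (ρ i) x ⇔ e i ≡ x
    subsets  : ∀ i x → sets P (σ i) x ⇔ s i x
open Represents

represents-point : ∀ {m k p P e s} {ρ : Fin m → Fin p} {σ : Fin k → Fin p} → Represents P ρ σ e s → ∀ a →
                   Represents (P ◂ ｛ a ｝) (zero Vec.∷ (suc ∘ ρ)) (suc ∘ σ) (a Vec.∷ e) s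
represents-point r a .elements zero    x = ⇔.refl
represents-point r a .elements (suc i) x = elements r i x
represents-point r a .subsets          = subsets r

represents-set : ∀ {m k p P e s} {ρ : Fin m → Fin p} {σ : Fin k → Fin p} → Represents P ρ σ e s → ∀ X →
                 Represents (P ◂ X) (suc ∘ ρ) (zero Vec.∷ (suc ∘ σ)) e (X Vec.∷ s)
represents-set r X .elements          = elements r
represents-set r X .subsets zero    x = ⇔.refl
represents-set r X .subsets (suc i) x = subsets r i x

-- One direction for arbitrary `P` and `Q` is enough, since the negation case runs it backwards
-- through `≈-sym`. Equality and membership are both read off `⊆̇` at a singleton.
transfer : ∀ {m k p n P Q e s f t} {ρ : Fin m → Fin p} {σ : Fin k → Fin p}
           (φ : Formula m k) → rank φ ℕ.≤ n → P ≈[ n ] Q →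
           Represents P ρ σ e s → Represents Q ρ σ f t →
           Semantics.Sat (order P) φ e s → Semantics.Sat (order Q) φ f t
transfer {e = e} {f = f} {ρ = ρ} (x ≐ y) _ P≈Q r q (lift ex≡ey) =
  lift (sym (to (elements q y (f x))
    (to (≈⇒atoms P≈Q (ρ x ⊆̇ ρ y))
      (λ z ρxz → from (elements r y z) (trans (sym ex≡ey) (to (elements r x z) ρxz)))
      (f x) (from (elements q x (f x)) refl))))
transfer {Q = Q} {e} {f = f} {ρ = ρ} (x ≺ y) _ P≈Q r q (lift ex<ey) =
  let a , b , ρa , ρb , a<b = to (≈⇒atoms P≈Q (ρ x <̇ ρ y))
        (e x , e y , from (elements r x (e x)) refl , from (elements r y (e y)) refl , ex<ey)
  in lift (subst₂ (Order._<_ (order Q)) (sym (to (elements q x a) ρa)) (sym (to (elements q y b) ρb)) a<b)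
transfer {P = P} {e = e} {f = f} {ρ = ρ} {σ = σ} (x ∈̇ X) _ P≈Q r q (lift ex∈X) =
  lift (to (subsets q X (f x)) (to (≈⇒atoms P≈Q (ρ x ⊆̇ σ X))
    (λ z ρxz → subst (sets P (σ X)) (to (elements r x z) ρxz) (from (subsets r X (e x)) ex∈X))
    (f x) (from (elements q x (f x)) refl)))
transfer (¬̇ φ) φ≤n P≈Q r q ¬Pφ Qφ = ¬Pφ (transfer φ φ≤n (≈-sym P≈Q) q r Qφ)
transfer (φ ∧̇ ψ) φψ≤n P≈Q r q (Pφ , Pψ) =
  transfer φ (ℕ.m⊔n≤o⇒m≤o (rank φ) (rank ψ) φψ≤n) P≈Q r q Pφ ,
  transfer ψ (ℕ.m⊔n≤o⇒n≤o (rank φ) (rank ψ) φψ≤n) P≈Q r q Pψ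
transfer (∃ᵉ φ) (s≤s φ≤n) P≈Q r q (a , Pφ) =
  let b , e = ≈-point (≈-sym P≈Q) a
  in b , transfer φ φ≤n (≈-sym e) (represents-point r a) (represents-point q b) Pφ
transfer (∃ˢ φ) (s≤s φ≤n) P≈Q r q (X , Pφ) =
  let Y , e = ≈-forth P≈Q X
  in Y , transfer φ φ≤n e (represents-set r X) (represents-set q Y) Pφ

≈⇒⊨ : ∀ {M N} ψ → ⟦ M ⟧ ≈[ rank ψ ] ⟦ N ⟧ → M ⊨ ψ → N ⊨ ψ
≈⇒⊨ {M} {N} ψ e = transfer ψ ℕ.≤-refl e empty empty
  where
  empty : ∀ {M} → Represents ⟦ M ⟧ Vec.[] Vec.[] Vec.[] Vec.[]
  empty = record { elements = λ () ; subsets = λ () }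

-- First-order formulas

-- A first-order language whose free variables are the sets of a position, the
-- quantified elements being singletons again.
infixr 5 _⇒_
infixr 6 _∧_

data FO (p : ℕ) : Set where
  atom    : Atom p → FO p
  ⊥̇       : FO p
  _⇒_ _∧_ : FO p → FO p → FO p
  ∀ᶠ ∃ᶠ   : FO (suc p) → FO p

FOSat : (P : Position p) → FO p → Set
FOSat P (atom a) = Holds P a
FOSat P ⊥̇        = ⊥
FOSat P (φ ⇒ ψ)  = FOSat P φ → FOSat P ψ
FOSat P (φ ∧ ψ)  = FOSat P φ × FOSat P ψ
FOSat P (∀ᶠ φ)   = ∀ a → FOSat (P ◂ ｛ a ｝) φ
FOSat P (∃ᶠ φ)   = ∃[ a ] FOSat (P ◂ ｛ a ｝) φ

FOrank : FO p → ℕ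
FOrank (atom _) = 0
FOrank ⊥̇        = 0
FOrank (φ ⇒ ψ)  = FOrank φ ⊔ FOrank ψ
FOrank (φ ∧ ψ)  = FOrank φ ⊔ FOrank ψ
FOrank (∀ᶠ φ)   = suc (FOrank φ)
FOrank (∃ᶠ φ)   = suc (FOrank φ)

FO-transfer : (φ : FO p) → FOrank φ ℕ.≤ n → P ≈[ n ] Q → FOSat P φ → FOSat Q φ
FO-transfer (atom a) _ e Pφ = to (≈⇒atoms e a) Pφ
FO-transfer (φ ⇒ ψ) r e Pφψ =
  FO-transfer ψ (ℕ.m⊔n≤o⇒n≤o (FOrank φ) (FOrank ψ) r) e ∘ Pφψ ∘
  FO-transfer φ (ℕ.m⊔n≤o⇒m≤o (FOrank φ) (FOrank ψ) r) (≈-sym e)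
FO-transfer (φ ∧ ψ) r e (Pφ , Pψ) =
  FO-transfer φ (ℕ.m⊔n≤o⇒m≤o (FOrank φ) (FOrank ψ) r) e Pφ ,
  FO-transfer ψ (ℕ.m⊔n≤o⇒n≤o (FOrank φ) (FOrank ψ) r) e Pψ
FO-transfer (∀ᶠ φ) (s≤s r) e Pφ b = let a , e′ = ≈-point e b in FO-transfer φ r e′ (Pφ a)
FO-transfer (∃ᶠ φ) (s≤s r) e (a , Pφ) =
  let b , e′ = ≈-point (≈-sym e) a in b , FO-transfer φ r (≈-sym e′) Pφ

module FiniteIndex (em : ∀ ℓ → ExcludedMiddle ℓ) where
  completeTypes-realised : ∀ (P : Position p) Φ → ∃[ χ ] χ ∈ₗ completeTypes Φ × P ⊩ χ
  completeTypes-realised P []      = ⊤̇ , here refl , Order.inhabited (order P) , lift refl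
  completeTypes-realised P (φ ∷ Φ) with completeTypes-realised P Φ | em (lsuc 0ℓ) {P ⊩ φ}
  ... | χ , χ∈ , Pχ | yes Pφ = φ ∧̇ χ , ∈-++⁺ˡ (∈-map⁺ (φ ∧̇_) χ∈) , Pφ , Pχ
  ... | χ , χ∈ , Pχ | no ¬Pφ =
    ¬̇ φ ∧̇ χ , ∈-++⁺ʳ (map (φ ∧̇_) (completeTypes Φ)) (∈-map⁺ (¬̇ φ ∧̇_) χ∈) , ¬Pφ , Pχ

  ⊩-atom : ∀ (P : Position p) a → P ⊩ atomFormula a ⇔ Holds P a
  ⊩-atom P (i ⊆̇ j) = mk⇔
    (λ h x six → case em 0ℓ {sets P j x} of λ
      { (yes sjx) → sjx
      ; (no ¬sjx) → ⊥-elim (h (x , lift six , λ { (lift sjx) → ¬sjx sjx })) })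
    (λ h → λ { (x , lift six , ¬sjx) → ¬sjx (lift (h x six)) })
  ⊩-atom P (i <̇ j) = mk⇔
    (λ { (x , y , lift six , lift sjy , lift x<y) → x , y , six , sjy , x<y })
    (λ { (x , y , six , sjy , x<y) → x , y , lift six , lift sjy , lift x<y })
  ⊩-atom P (ne i)  = mk⇔ (λ { (x , lift six) → x , six }) (λ { (x , six) → x , lift six })

  agree⇒sameAtoms : Agree (map atomFormula (atoms p)) P Q → SameAtoms P Q
  agree⇒sameAtoms {P = P} {Q} agree a =
    ⇔.trans (⇔.sym (⊩-atom P a)) (⇔.trans (agree (∈-map⁺ atomFormula (∈-atoms a))) (⊩-atom Q a))

  -- The reply to `X` is found from the complete type of `P ◂ X`: that some set realises this type
  -- is one of the listed formulas, so it also holds in `Q`.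
  agree⇒≈ : ∀ n → Agree (hintikka n p) P Q → P ≈[ n ] Q
  agree⇒≈ zero agree = stop (agree⇒sameAtoms agree)
  agree⇒≈ {p} {P} {Q} (suc n) agree =
    move (agree⇒sameAtoms (λ φ∈ → agree (∈-++⁺ˡ φ∈)))
      (λ X → let χ , χ∈ , Xχ = completeTypes-realised (P ◂ X) (hintikka n (suc p))
                 Y , Yχ = to (agree (type∈ χ∈)) (X , Xχ)
             in Y , agree⇒≈ n (completeTypes-sound (hintikka n (suc p)) χ∈ Xχ Yχ))
      (λ Y → let χ , χ∈ , Yχ = completeTypes-realised (Q ◂ Y) (hintikka n (suc p))
                 X , Xχ = from (agree (type∈ χ∈)) (Y , Yχ)
             in X , agree⇒≈ n (completeTypes-sound (hintikka n (suc p)) χ∈ Xχ Yχ))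
    where
    type∈ : ∀ {χ} → χ ∈ₗ completeTypes (hintikka n (suc p)) → ∃ˢ χ ∈ₗ hintikka (suc n) p
    type∈ χ∈ = ∈-++⁺ʳ (map atomFormula (atoms p)) (∈-map⁺ ∃ˢ χ∈)

  characteristic : ∀ n M → ∃[ χ ] M ⊨ χ × (∀ N → N ⊨ χ → ⟦ M ⟧ ≈[ n ] ⟦ N ⟧)
  characteristic n M = let χ , χ∈ , Mχ = completeTypes-realised ⟦ M ⟧ (hintikka n 0) in
    χ , Mχ , λ N Nχ → agree⇒≈ n (completeTypes-sound (hintikka n 0) χ∈ Mχ Nχ)

  colours : ℕ → ℕ
  colours n = length (completeTypes (hintikka n 0))

  -- Colour zero is unused; it makes the set of colours nonempty, as the index set
  -- of a shuffle must be.
  colour : ∀ n → LinearOrder → Fin (suc (colours n))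
  colour n M = let _ , χ∈ , _ = completeTypes-realised ⟦ M ⟧ (hintikka n 0) in suc (index χ∈)

  colour⇒≈ : ∀ n {M N} → colour n M ≡ colour n N → ⟦ M ⟧ ≈[ n ] ⟦ N ⟧
  colour⇒≈ n {M} {N} eq
    with completeTypes-realised ⟦ M ⟧ (hintikka n 0) | completeTypes-realised ⟦ N ⟧ (hintikka n 0)
  ... | χ , χ∈ , Mχ | χ′ , χ′∈ , Nχ′ =
    agree⇒≈ n (completeTypes-sound (hintikka n 0) χ∈ Mχ (subst (N ⊨_) χ′≡χ Nχ′))
    where
    χ′≡χ : χ′ ≡ χ
    χ′≡χ = trans (lookup-index χ′∈) (trans
      (cong (lookup (completeTypes (hintikka n 0))) (Fin.suc-injective (sym eq))) (sym (lookup-index χ∈)))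

-- Back and forth

record Unbounded (M : LinearOrder) : Set where
  open Order M
  field
    above : ∀ x → ∃[ y ] x < y
    below : ∀ x → ∃[ y ] y < x

-- Match plays the part of "has the same colour" in the coloured version of
-- Cantor's theorem.
module BackAndForth (em : ∀ ℓ → ExcludedMiddle ℓ) where

  -- Applied to an order and to its reverse, this finds the already matched points nearest to a new
  -- point on either side.
  Maximum : ∀ M {A : Set} → (A → Carrier M) → Pred A 0ℓ → List A → Set
  Maximum M f Q as = (∀ {a} → a ∈ₗ as → ¬ Q a) ⊎
    ∃[ a ] a ∈ₗ as × Q a × (∀ {b} → b ∈ₗ as → Q b → Order._≤_ M (f b) (f a))

  maximum : ∀ M {A : Set} (f : A → Carrier M) (Q : Pred A 0ℓ) as → Maximum M f Q as
  maximum M f Q [] = inj₁ λ ()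
  maximum M f Q (a ∷ as) with em 0ℓ {Q a} | maximum M f Q as
  ... | no ¬Qa | inj₁ none = inj₁ λ { (here refl) → ¬Qa ; (there b∈) → none b∈ }
  ... | no ¬Qa | inj₂ (b , b∈ , Qb , max) = inj₂ (b , there b∈ , Qb , λ
    { (here refl) Qa → contradiction Qa ¬Qa ; (there c∈) → max c∈ })
  ... | yes Qa | inj₁ none = inj₂ (a , here refl , Qa , λ
    { (here refl) _ → Order.≤-refl M ; (there c∈) Qc → contradiction Qc (none c∈) })
  ... | yes Qa | inj₂ (b , b∈ , Qb , max) with Order.<⊎≥ M (f b) (f a)
  ...   | inj₁ b<a = inj₂ (a , here refl , Qa , λ
    { (here refl) _ → Order.≤-refl M
    ; (there c∈) Qc → Order.≤-trans M (max c∈ Qc) (Order.<⇒≤ M b<a) })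
  ...   | inj₂ a≤b = inj₂ (b , there b∈ , Qb , λ
    { (here refl) _ → a≤b ; (there c∈) Qc → max c∈ Qc })

  -- The two coordinates of the pairs are parameters, so the same argument serves the forth and the
  -- back step. Where a neighbour is missing on one side, unboundedness of `B` supplies the end of
  -- the interval.
  module Gap (A B : LinearOrder) (unbounded : Unbounded B) {P : Set} (a : P → Carrier A) (b : P → Carrier B) where
    private
      module A = Order A
      module B = Order B
    open Unbounded unbounded

    Room : List P → Carrier A → Set
    Room ps x = ∃₂ λ y y′ → y B.< y′ × (∀ {z} → y B.< z → z B.< y′ → ∀ {p} → p ∈ₗ ps →
      (a p A.< x × b p B.< z) ⊎ (x A.< a p × z B.< b p))

    gap : ∀ ps → (∀ {p q} → p ∈ₗ ps → q ∈ₗ ps → a p A.< a q ⇔ b p B.< b q) →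
          ∀ x → (∃[ p ] p ∈ₗ ps × a p ≡ x) ⊎ Room ps x
    gap ps ord x with em 0ℓ {∃[ p ] p ∈ₗ ps × a p ≡ x}
    ... | yes old = inj₁ old
    ... | no new = inj₂ (choose (maximum A a (λ p → a p A.< x) ps) (maximum (A ᵒᵖ) a (λ p → x A.< a p) ps))
      where
      separated : ∀ {y y′} → (∀ {p} → p ∈ₗ ps → a p A.< x → b p B.≤ y) →
                  (∀ {p} → p ∈ₗ ps → x A.< a p → y′ B.≤ b p) →
                  ∀ {z} → y B.< z → z B.< y′ → ∀ {p} → p ∈ₗ ps →
                  (a p A.< x × b p B.< z) ⊎ (x A.< a p × z B.< b p)
      separated low high y<z z<y′ {p} p∈ with A.compare (a p) x
      ... | tri< ap<x _ _ = inj₁ (ap<x , B.≤-<-trans (low p∈ ap<x) y<z)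
      ... | tri≈ _ ap≡x _ = contradiction (p , p∈ , ap≡x) new
      ... | tri> _ _ x<ap = inj₂ (x<ap , B.<-≤-trans z<y′ (high p∈ x<ap))

      choose : Maximum A a (λ p → a p A.< x) ps → Maximum (A ᵒᵖ) a (λ p → x A.< a p) ps → Room ps x
      choose (inj₁ noLow) (inj₁ noHigh) =
        let y = B.inhabited ; y′ , y<y′ = above y in
        y , y′ , y<y′ , separated (λ p∈ lo → contradiction lo (noLow p∈)) (λ p∈ hi → contradiction hi (noHigh p∈))
      choose (inj₂ (p , p∈ , ap<x , max)) (inj₁ noHigh) =
        let y′ , y<y′ = above (b p) in
        b p , y′ , y<y′ , separated (λ q∈ lo → max q∈ lo ∘ from (ord p∈ q∈)) (λ q∈ hi → contradiction hi (noHigh q∈))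
      choose (inj₁ noLow) (inj₂ (p , p∈ , x<ap , min)) =
        let y , y<y′ = below (b p) in
        y , b p , y<y′ , separated (λ q∈ lo → contradiction lo (noLow q∈)) (λ q∈ hi → min q∈ hi ∘ from (ord q∈ p∈))
      choose (inj₂ (p , p∈ , ap<x , max)) (inj₂ (q , q∈ , x<aq , min)) =
        b p , b q , to (ord p∈ q∈) (A.<-trans ap<x x<aq) ,
        separated (λ r∈ lo → max r∈ lo ∘ from (ord p∈ r∈)) (λ r∈ hi → min r∈ hi ∘ from (ord r∈ q∈))

  module _ (I J : LinearOrder) (I↣ℕ : Countable I) (J↣ℕ : Countable J)
           (I-unbounded : Unbounded I) (J-unbounded : Unbounded J)
           (Match : Carrier I → Carrier J → Set)
           (fillJ : ∀ x {y y′} → Order._<_ J y y′ → ∃[ z ] Match x z × Order._<_ J y z × Order._<_ J z y′)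
           (fillI : ∀ y {x x′} → Order._<_ I x x′ → ∃[ z ] Match z y × Order._<_ I x z × Order._<_ I z x′)
           where
    private
      module I = Order I
      module J = Order J
      codeI = Injection.to I↣ℕ
      codeJ = Injection.to J↣ℕ

    record PartialIso : Set where
      field
        pairs : List (Carrier I × Carrier J)
        ord   : ∀ {p q} → p ∈ₗ pairs → q ∈ₗ pairs → proj₁ p I.< proj₁ q ⇔ proj₂ p J.< proj₂ q
        match : ∀ {p} → p ∈ₗ pairs → Match (proj₁ p) (proj₂ p)
    open PartialIso

    Extends : PartialIso → PartialIso → Set
    Extends F G = ∀ {p} → p ∈ₗ pairs F → p ∈ₗ pairs G

    insert : ∀ F {x y} → Match x y →
             (∀ {p} → p ∈ₗ pairs F → (proj₁ p I.< x × proj₂ p J.< y) ⊎ (x I.< proj₁ p × y J.< proj₂ p)) →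
             PartialIso
    insert F {x} {y} m s .pairs = (x , y) ∷ pairs F
    insert F m s .match (here refl) = m
    insert F m s .match (there p∈)  = match F p∈
    insert F m s .ord (here refl) (here refl) =
      mk⇔ (λ x<x → contradiction x<x I.≤-refl) (λ y<y → contradiction y<y J.≤-refl)
    insert F m s .ord (here refl) (there q∈) with s q∈
    ... | inj₁ (q<x , q<y) = mk⇔ (λ x<q → contradiction x<q (I.asym q<x)) (λ y<q → contradiction y<q (J.asym q<y))
    ... | inj₂ (x<q , y<q) = mk⇔ (const y<q) (const x<q)
    insert F m s .ord (there p∈) (here refl) with s p∈
    ... | inj₁ (p<x , p<y) = mk⇔ (const p<y) (const p<x)
    ... | inj₂ (x<p , y<p) = mk⇔ (λ p<x → contradiction p<x (I.asym x<p)) (λ p<y → contradiction p<y (J.asym y<p))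
    insert F m s .ord (there p∈) (there q∈) = ord F p∈ q∈

    forth : ∀ F x → ∃[ G ] Extends F G × ∃[ y ] (x , y) ∈ₗ pairs G
    forth F x with Gap.gap I J J-unbounded proj₁ proj₂ (pairs F) (ord F) x
    ... | inj₁ ((x , y) , p∈ , refl) = F , id , y , p∈
    ... | inj₂ (_ , _ , l<u , sep) =
      let z , m , l<z , z<u = fillJ x l<u in insert F m (sep l<z z<u) , there , z , here refl

    back : ∀ F y → ∃[ G ] Extends F G × ∃[ x ] (x , y) ∈ₗ pairs G
    back F y with Gap.gap J I I-unbounded proj₂ proj₁ (pairs F) (λ p∈ q∈ → ⇔.sym (ord F p∈ q∈)) y
    ... | inj₁ ((x , y) , p∈ , refl) = F , id , x , p∈
    ... | inj₂ (_ , _ , l<u , sep) =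
      let z , m , l<z , z<u = fillI y l<u
      in insert F m (λ p∈ → [ inj₁ ∘ swap , inj₂ ∘ swap ]′ (sep l<z z<u p∈)) , there , z , here refl

    -- Stage `k` takes care of the element with code `k` on each side, if there is one; injectivity
    -- of the codes makes it the only one.
    step : ∀ F k → ∃[ G ] Extends F G × (∀ x → codeI x ≡ k → ∃[ y ] (x , y) ∈ₗ pairs G) ×
                          (∀ y → codeJ y ≡ k → ∃[ x ] (x , y) ∈ₗ pairs G)
    step F k with em 0ℓ {∃[ x ] codeI x ≡ k} | em 0ℓ {∃[ y ] codeJ y ≡ k}
    ... | no ¬x | no ¬y = F , id , (λ x eq → contradiction (x , eq) ¬x) , (λ y eq → contradiction (y , eq) ¬y)
    ... | yes (x , refl) | no ¬y =
      let G , F⊆G , y , xy∈ = forth F x in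
      G , F⊆G , (λ x′ eq → case Injection.injective I↣ℕ eq of λ { refl → y , xy∈ }) ,
      (λ y eq → contradiction (y , eq) ¬y)
    ... | no ¬x | yes (y , refl) =
      let G , F⊆G , x , xy∈ = back F y in
      G , F⊆G , (λ x eq → contradiction (x , eq) ¬x) ,
      (λ y′ eq → case Injection.injective J↣ℕ eq of λ { refl → x , xy∈ })
    ... | yes (x , refl) | yes (y , eq) =
      let G , F⊆G , y₁ , xy₁∈ = forth F x
          H , G⊆H , x₁ , x₁y∈ = back G y in
      H , G⊆H ∘ F⊆G , (λ x′ eq′ → case Injection.injective I↣ℕ eq′ of λ { refl → y₁ , G⊆H xy₁∈ }) ,
      (λ y′ eq′ → case Injection.injective J↣ℕ (trans eq′ (sym eq)) of λ { refl → x₁ , x₁y∈ })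

    stage : ℕ → PartialIso
    stage zero    = record { pairs = [] ; ord = λ () ; match = λ () }
    stage (suc k) = proj₁ (step (stage k) k)

    stage-mono : ∀ {k l} → k ℕ.≤ l → Extends (stage k) (stage l)
    stage-mono k≤l = go (ℕ.≤⇒≤′ k≤l)
      where
      go : ∀ {k l} → k ℕ.≤′ l → Extends (stage k) (stage l)
      go ℕ.≤′-refl                 p∈ = p∈
      go (ℕ.≤′-step {n = l} k≤′l) p∈ = proj₁ (proj₂ (step (stage l) l)) (go k≤′l p∈)

    limit-ord : ∀ {k l p q} → p ∈ₗ pairs (stage k) → q ∈ₗ pairs (stage l) →
                proj₁ p I.< proj₁ q ⇔ proj₂ p J.< proj₂ q
    limit-ord {k} {l} p∈ q∈ = ord (stage (k ⊔ l)) (stage-mono (ℕ.m≤m⊔n k l) p∈) (stage-mono (ℕ.m≤n⊔m k l) q∈)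

    domain : ∀ x → ∃[ y ] (x , y) ∈ₗ pairs (stage (suc (codeI x)))
    domain x = proj₁ (proj₂ (proj₂ (step (stage (codeI x)) (codeI x)))) x refl

    range : ∀ y → ∃[ x ] (x , y) ∈ₗ pairs (stage (suc (codeJ y)))
    range y = proj₂ (proj₂ (proj₂ (step (stage (codeJ y)) (codeJ y)))) y refl

    backAndForth : ∃[ I≅J ] ∀ x → Match x (Iso.fun {I} {J} I≅J x)
    backAndForth =
      ≅-intro {I} {J} (proj₁ ∘ domain)
        (λ {x} {x′} → to (limit-ord {suc (codeI x)} {suc (codeI x′)} (proj₂ (domain x)) (proj₂ (domain x′))))
        surj ,
      λ x → match (stage (suc (codeI x))) (proj₂ (domain x))
      where
      surj : ∀ y → ∃[ x ] proj₁ (domain x) ≡ y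
      -- The partner chosen for `x` may come from another stage than the pair `(x , y)`; in a common
      -- stage equal first coordinates force equal second ones.
      surj y = let x , xy∈ = range y ; _ , xy′∈ = domain x in
        x , J.≤-antisym (I.≤-refl ∘ from (limit-ord {suc (codeJ y)} {suc (codeI x)} xy∈ xy′∈))
                        (I.≤-refl ∘ from (limit-ord {suc (codeI x)} {suc (codeJ y)} xy′∈ xy∈))

-- Countability

-- The number 2^m (2n + 1).
pair : ℕ → ℕ → ℕ
pair zero    n = suc (2 ℕ.* n)
pair (suc m) n = 2 ℕ.* pair m n

pair-injective : ∀ m n m′ n′ → pair m n ≡ pair m′ n′ → m ≡ m′ × n ≡ n′
pair-injective zero    n zero     n′ eq = refl , ℕ.*-cancelˡ-≡ n n′ 2 (ℕ.suc-injective eq)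
pair-injective zero    n (suc m′) n′ eq = contradiction (sym eq) (ℕ.even≢odd (pair m′ n′) n)
pair-injective (suc m) n zero     n′ eq = contradiction eq (ℕ.even≢odd (pair m n) n′)
pair-injective (suc m) n (suc m′) n′ eq =
  let m≡m′ , n≡n′ = pair-injective m n m′ n′ (ℕ.*-cancelˡ-≡ _ _ 2 eq) in cong suc m≡m′ , n≡n′

∑-countable : ∀ I M → Countable I → (∀ i → Countable (M i)) → Countable (∑ I M)
∑-countable I M I↣ℕ M↣ℕ = mk↣ {to = code} λ {a} {b} → injective {a} {b}
  where
  code : Carrier (∑ I M) → ℕ
  code (i , x) = pair (Injection.to I↣ℕ i) (Injection.to (M↣ℕ i) x)

  injective : ∀ {a b} → code a ≡ code b → a ≡ b
  injective {i , x} {j , y} eq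
    with pair-injective (Injection.to I↣ℕ i) (Injection.to (M↣ℕ i) x) (Injection.to I↣ℕ j) (Injection.to (M↣ℕ j) y) eq
  ... | i≡j , x≡y with Injection.injective I↣ℕ i≡j
  ...   | refl = cong (i ,_) (Injection.injective (M↣ℕ i) x≡y)

index-countable : ∀ I M → Countable (∑ I M) → Countable I
index-countable I M ∑↣ℕ = mk↣ {to = λ i → Injection.to ∑↣ℕ (i , LinearOrder.inhabited (M i))}
  (cong proj₁ ∘ Injection.injective ∑↣ℕ)

summand-countable : ∀ I M → Countable (∑ I M) → ∀ i → Countable (M i)
summand-countable I M ∑↣ℕ i = mk↣ {to = λ x → Injection.to ∑↣ℕ (i , x)} (pair-≡ ∘ Injection.injective ∑↣ℕ)
  where
  pair-≡ : ∀ {x y : Carrier (M i)} → _≡_ {A = Carrier (∑ I M)} (i , x) (i , y) → x ≡ y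
  pair-≡ refl = refl

η-countable : Countable η
η-countable = mk↣ {to = code} injective
  where
  ℤ-code : ℤ → ℕ
  ℤ-code (ℤ.+ n)  = pair 0 n
  ℤ-code -[1+ n ] = pair 1 n

  ℤ-code-injective : ∀ {i j} → ℤ-code i ≡ ℤ-code j → i ≡ j
  ℤ-code-injective {ℤ.+ m}    {ℤ.+ n}    eq = cong ℤ.+_ (proj₂ (pair-injective 0 m 0 n eq))
  ℤ-code-injective {ℤ.+ m}    { -[1+ n ]} eq = contradiction (proj₁ (pair-injective 0 m 1 n eq)) λ ()
  ℤ-code-injective { -[1+ m ]} {ℤ.+ n}    eq = contradiction (proj₁ (pair-injective 1 m 0 n eq)) λ ()
  ℤ-code-injective { -[1+ m ]} { -[1+ n ]} eq = cong -[1+_] (proj₂ (pair-injective 1 m 1 n eq))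

  code : ℚ → ℕ
  code (mkℚ i d _) = pair (ℤ-code i) d

  injective : ∀ {p q} → code p ≡ code q → p ≡ q
  injective {mkℚ i d _} {mkℚ j e _} eq with pair-injective (ℤ-code i) d (ℤ-code j) e eq
  ... | i≡j , refl with ℤ-code-injective {i} {j} i≡j
  ...   | refl = refl

η-unbounded : Unbounded η
η-unbounded = record
  { above = λ p → p ℚ.+ ℚ.1ℚ , subst (ℚ._< p ℚ.+ ℚ.1ℚ) (ℚ.+-identityʳ p) (ℚ.+-monoʳ-< p (ℚ.positive⁻¹ ℚ.1ℚ))
  ; below = λ p → p ℚ.- ℚ.1ℚ , subst (p ℚ.- ℚ.1ℚ ℚ.<_) (ℚ.+-identityʳ p) (ℚ.+-monoʳ-< p (ℚ.negative⁻¹ (ℚ.- ℚ.1ℚ)))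
  }

𝕄⇒countable : ∀ {M} → M ∈ 𝕄 → Countable M
𝕄⇒countable one = mk↣ {to = toℕ} Fin.toℕ-injective
𝕄⇒countable (sum {M} {N} m n) = ∑-countable 𝟐 (λ b → if b then N else M) 𝟐-countable
  λ { false → 𝕄⇒countable m ; true → 𝕄⇒countable n }
  where
  𝟐-countable : Countable 𝟐
  𝟐-countable = mk↣ {to = λ b → if b then 1 else 0}
    λ { {false} {false} _ → refl ; {true} {true} _ → refl }
𝕄⇒countable (times-ω {M} m)  = ∑-countable ω (const M) (mk↣ {to = id} id) (const (𝕄⇒countable m))
𝕄⇒countable (times-ω* {M} m) = ∑-countable (ω ᵒᵖ) (const M) (mk↣ {to = id} id) (const (𝕄⇒countable m))
𝕄⇒countable (shuffle {M = M} {Mₐ} m s) = ∑-countable η Mₐ η-countable λ a →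
  let i , Mₐ≅Mᵢ = IsShuffleOf.covered s a in ≅-countable {M i} {Mₐ a} (≅-sym {Mₐ a} {M i} Mₐ≅Mᵢ) (𝕄⇒countable (m i))
𝕄⇒countable (iso {M} {N} M≅N m) = ≅-countable {M} {N} M≅N (𝕄⇒countable m)

-- Decomposing an order equivalent to a sum

-- With X a colouring and P a set of representatives of the summands, this defines
-- "lie in the same summand" inside a sum, provided the colouring satisfies Separates.
Near : ∀ M → (X P : Pred (Carrier M) 0ℓ) → Carrier M → Carrier M → Set
Near M X P a b = ∀ z w → z ∈ Between a b → w ∈ Between a b → (X z → X w) × (P z → P w → z ≡ w)
  where open Order M

module NearProperties (M : LinearOrder) (X P : Pred (Carrier M) 0ℓ) where
  open Order M

  near-refl : ∀ a → Near M X P a a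
  near-refl a z w z∈ w∈ with between-≡ z∈ | between-≡ w∈
    where
    between-≡ : ∀ {z} → z ∈ Between a a → a ≡ z
    between-≡ z∈ = let a≤z , z≤a = between-≤ z∈ ≤-refl in ≤-antisym a≤z z≤a
  ... | refl | refl = id , λ _ _ → refl

  near-sym : ∀ {a b} → Near M X P a b → Near M X P b a
  near-sym near z w z∈ w∈ = near z w (between-sym z∈) (between-sym w∈)

-- Each alternative defeats one clause of `Near` for points of different summands: two colours, or
-- two representatives. The second asks for indices strictly inside, as the representatives of the
-- end summands may lie outside the interval. Dense index orders satisfy the second; two points and
-- ω need a colouring.
Separates : ∀ I → Pred (Carrier I) 0ℓ → Set
Separates I X = ∀ {i j} → i < j →
  (∃₂ λ k l → (i ≤ k × k ≤ j) × (i ≤ l × l ≤ j) × X k × ¬ X l) ⊎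
  (∃₂ λ k l → i < k × k < l × l < j)
  where open Order I

module NearInSum (I : LinearOrder) (M : Carrier I → LinearOrder) (X : Pred (Carrier I) 0ℓ)
                 (separates : Separates I X) where
  private
    module I = Order I
    module A = Order (∑ I M)
    open OrderedSum
    point = λ i → LinearOrder.inhabited (M i)

  Coloured Representative : Pred (Carrier (∑ I M)) 0ℓ
  Coloured (i , _)       = X i
  Representative (i , x) = point i ≡ x

  _∼_ : Carrier (∑ I M) → Carrier (∑ I M) → Set
  _∼_ = Near (∑ I M) Coloured Representative

  -- At the end indices `a` and `b` themselves serve, because the inhabitant chosen in their summand
  -- may lie beyond them.
  hit : ∀ a b {k} → proj₁ a I.< proj₁ b → proj₁ a I.≤ k → k I.≤ proj₁ b →
        ∃[ z ] z ∈ A.Between a b × proj₁ z ≡ k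
  hit a b {k} i<j i≤k k≤j with I.compare (proj₁ a) k | I.compare k (proj₁ b)
  ... | tri≈ _ refl _ | _             = a , A.between⁺ A.≤-refl (A.asym (across i<j)) , refl
  ... | _             | tri≈ _ refl _ = b , A.between⁺ (A.asym (across i<j)) A.≤-refl , refl
  ... | tri> _ _ k<i  | _             = contradiction k<i i≤k
  ... | _             | tri> _ _ j<k  = contradiction j<k k≤j
  ... | tri< i<k _ _  | tri< k<j _ _  = (k , point k) , A.between⁺ (A.asym (across i<k)) (A.asym (across k<j)) , refl

  ∼⇒≮ : ∀ a b → a ∼ b → ¬ proj₁ a I.< proj₁ b
  ∼⇒≮ a b a∼b i<j with separates i<j
  ... | inj₁ (k , l , (i≤k , k≤j) , (i≤l , l≤j) , Xk , ¬Xl) with hit a b i<j i≤k k≤j | hit a b i<j i≤l l≤j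
  ...   | z , z∈ , refl | w , w∈ , refl = ¬Xl (proj₁ (a∼b z w z∈ w∈) Xk)
  ∼⇒≮ a b a∼b i<j | inj₂ (k , l , i<k , k<l , l<j) = I.irrefl (cong proj₁ k≡l) k<l
    where
    k≡l = proj₂ (a∼b (k , point k) (l , point l)
      (A.between⁺ (A.asym (across i<k)) (A.asym (across (I.<-trans k<l l<j))))
      (A.between⁺ (A.asym (across (I.<-trans i<k k<l))) (A.asym (across l<j)))) refl refl

  ∼⇒≡ : ∀ {a b} → a ∼ b → proj₁ a ≡ proj₁ b
  ∼⇒≡ {a} {b} a∼b = I.≤-antisym (∼⇒≮ b a (near-sym a∼b)) (∼⇒≮ a b a∼b)
    where open NearProperties (∑ I M) Coloured Representative

  ≡⇒∼ : ∀ {a b} → proj₁ a ≡ proj₁ b → a ∼ b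
  ≡⇒∼ {i , x} {_ , y} refl (k , z) (l , w) z∈ w∈ with same z∈ | same w∈
    where
    same : ∀ {k z} → (k , z) ∈ A.Between (i , x) (i , y) → i ≡ k
    same (¬below , ¬above) = I.≤-antisym
      (λ k<i → ¬below (across k<i , across k<i)) (λ i<k → ¬above (across i<k , across i<k))
  ... | refl | refl = id , λ { refl refl → refl }

  ∼-cover : ∀ a → ∃[ r ] Representative r × a ∼ r
  ∼-cover (i , x) = (i , point i) , refl , ≡⇒∼ refl

  ∼-ordered : ∀ {a b r s} → a ∼ r → b ∼ s → Representative r → Representative s → r A.< s → a A.< b
  ∼-ordered a∼r b∼s r∈ s∈ r<s with ∼⇒≡ a∼r | ∼⇒≡ b∼s
  ∼-ordered a∼r b∼s r∈ s∈ (across i<j) | refl | refl = across i<j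
  ∼-ordered a∼r b∼s refl refl (within x<x) | refl | refl = contradiction (within x<x) A.≤-refl

-- First-order formulas describing a sum through colouring and representatives

betweenᶠ : (z x y : Fin p) → FO p
betweenᶠ z x y = (atom (z <̇ x) ∧ atom (z <̇ y) ⇒ ⊥̇) ∧ (atom (x <̇ z) ∧ atom (y <̇ z) ⇒ ⊥̇)

nearᶠ : (X P x y : Fin p) → FO p
nearᶠ X P x y = ∀ᶠ (∀ᶠ (
  betweenᶠ (suc zero) (suc (suc x)) (suc (suc y)) ⇒ betweenᶠ zero (suc (suc x)) (suc (suc y)) ⇒
  (atom (suc zero ⊆̇ suc (suc X)) ⇒ atom (zero ⊆̇ suc (suc X))) ∧
  (atom (suc zero ⊆̇ suc (suc P)) ⇒ atom (zero ⊆̇ suc (suc P)) ⇒ atom (suc zero ⊆̇ zero))))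

module _ (M : LinearOrder) where
  open Order M

  IsPoint : Vector (Pred (Carrier M) 0ℓ) p → Fin p → Carrier M → Set
  IsPoint s i a = ∀ z → s i z ⇔ a ≡ z

  <̇-point : ∀ {s : Vector (Pred (Carrier M) 0ℓ) p} {i j a b} → IsPoint s i a → IsPoint s j b →
            Holds (M ⊢ s) (i <̇ j) ⇔ a < b
  <̇-point i≡a j≡b = mk⇔
    (λ (x , y , six , sjy , x<y) → subst₂ _<_ (sym (to (i≡a x) six)) (sym (to (j≡b y) sjy)) x<y)
    (λ a<b → _ , _ , from (i≡a _) refl , from (j≡b _) refl , a<b)

  betweenᶠ-sound : ∀ {s : Vector (Pred (Carrier M) 0ℓ) p} {i j k a b c} →
                   IsPoint s i a → IsPoint s j b → IsPoint s k c →
                   FOSat (M ⊢ s) (betweenᶠ k i j) ⇔ c ∈ Between a b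
  betweenᶠ-sound {s = s} i j k = mk⇔
    (λ (p , q) → (λ (x , y) → p (from (<̇-point {s = s} k i) x , from (<̇-point {s = s} k j) y)) ,
                 (λ (x , y) → q (from (<̇-point {s = s} i k) x , from (<̇-point {s = s} j k) y)))
    (λ (p , q) → (λ (x , y) → p (to (<̇-point {s = s} k i) x , to (<̇-point {s = s} k j) y)) ,
                 (λ (x , y) → q (to (<̇-point {s = s} i k) x , to (<̇-point {s = s} j k) y)))

  nearᶠ-sound : ∀ {s : Vector (Pred (Carrier M) 0ℓ) p} {X P i j a b} → IsPoint s i a → IsPoint s j b →
                FOSat (M ⊢ s) (nearᶠ X P i j) ⇔ Near M (s X) (s P) a b
  nearᶠ-sound {s = s} {X} {P} {i} {j} {a} {b} ia jb = mk⇔ forth back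
    where
    inner : ∀ z w → Vector (Pred (Carrier M) 0ℓ) _
    inner z w = ｛ w ｝ Vec.∷ (｛ z ｝ Vec.∷ s)

    z-between : ∀ z w → FOSat (M ⊢ inner z w) (betweenᶠ (suc zero) (suc (suc i)) (suc (suc j))) ⇔ z ∈ Between a b
    z-between z w = betweenᶠ-sound {s = inner z w} {suc (suc i)} {suc (suc j)} {suc zero} ia jb (λ _ → ⇔.refl)

    w-between : ∀ z w → FOSat (M ⊢ inner z w) (betweenᶠ zero (suc (suc i)) (suc (suc j))) ⇔ w ∈ Between a b
    w-between z w = betweenᶠ-sound {s = inner z w} {suc (suc i)} {suc (suc j)} {zero} ia jb (λ _ → ⇔.refl)

    forth : FOSat (M ⊢ s) (nearᶠ X P i j) → Near M (s X) (s P) a b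
    forth h z w z∈ w∈ with h z w (from (z-between z w) z∈) (from (w-between z w) w∈)
    ... | c , r = (λ Xz → c (λ { _ refl → Xz }) w refl) ,
                  (λ Pz Pw → sym (r (λ { _ refl → Pz }) (λ { _ refl → Pw }) z refl))

    back : Near M (s X) (s P) a b → FOSat (M ⊢ s) (nearᶠ X P i j)
    back near z w z∈ w∈ with near z w (to (z-between z w) z∈) (to (w-between z w) w∈)
    ... | c , r = (λ Xz → λ { _ refl → c (Xz z refl) }) ,
                  (λ Pz Pw → λ { _ refl → sym (r (Pz z refl) (Pw w refl)) })

-- Set `0F` holds the representatives and `1F` the colouring. These two sentences are exactly what
-- `glue` asks of the classes of `Near`, so their transfer turns the other order into a sum.
coverᶠ orderedᶠ : FO 2
coverᶠ   = ∀ᶠ (∃ᶠ (atom (0F ⊆̇ 2F) ∧ nearᶠ 3F 2F 1F 0F))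
orderedᶠ = ∀ᶠ (∀ᶠ (∀ᶠ (∀ᶠ (nearᶠ 5F 4F 3F 1F ⇒ nearᶠ 5F 4F 2F 0F ⇒
  atom (1F ⊆̇ 4F) ⇒ atom (0F ⊆̇ 4F) ⇒ atom (1F <̇ 0F) ⇒ atom (3F <̇ 2F)))))

-- This makes the set `1F` the entire class of the point `0F`, so that Duplicator's reply to a whole
-- piece is a whole summand.
classᶠ : FO 5
classᶠ = ∀ᶠ ((atom (0F ⊆̇ 2F) ⇒ nearᶠ 5F 4F 0F 1F) ∧ (nearᶠ 5F 4F 0F 1F ⇒ atom (0F ⊆̇ 2F)))

module _ (M : LinearOrder) where
  open Order M

  Covers Orders : (X P : Pred (Carrier M) 0ℓ) → Set
  Covers X P = ∀ a → ∃[ r ] P r × Near M X P a r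
  Orders X P = ∀ a b r s → Near M X P a r → Near M X P b s → P r → P s → r < s → a < b

  coverᶠ-sound : ∀ X P → FOSat (⟦ M ⟧ ◂ X ◂ P) coverᶠ ⇔ Covers X P
  coverᶠ-sound X P = mk⇔ forth back
    where
    sound : ∀ a r → FOSat (⟦ M ⟧ ◂ X ◂ P ◂ ｛ a ｝ ◂ ｛ r ｝) (nearᶠ 3F 2F 1F 0F) ⇔ Near M X P a r
    sound a r = nearᶠ-sound M {s = sets (⟦ M ⟧ ◂ X ◂ P ◂ ｛ a ｝ ◂ ｛ r ｝)} {3F} {2F} {1F} {0F}
      (λ _ → ⇔.refl) (λ _ → ⇔.refl)

    forth : FOSat (⟦ M ⟧ ◂ X ◂ P) coverᶠ → Covers X P
    forth h a = let r , Pr , near = h a in r , Pr r refl , to (sound a r) near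

    back : Covers X P → FOSat (⟦ M ⟧ ◂ X ◂ P) coverᶠ
    back h a = let r , Pr , near = h a in r , (λ { _ refl → Pr }) , from (sound a r) near

  orderedᶠ-sound : ∀ X P → FOSat (⟦ M ⟧ ◂ X ◂ P) orderedᶠ ⇔ Orders X P
  orderedᶠ-sound X P = mk⇔ forth back
    where
    inner : ∀ a b r s → Position 6
    inner a b r s = ⟦ M ⟧ ◂ X ◂ P ◂ ｛ a ｝ ◂ ｛ b ｝ ◂ ｛ r ｝ ◂ ｛ s ｝

    left : ∀ a b r s → FOSat (inner a b r s) (nearᶠ 5F 4F 3F 1F) ⇔ Near M X P a r
    left a b r s = nearᶠ-sound M {s = sets (inner a b r s)} {5F} {4F} {3F} {1F} (λ _ → ⇔.refl) (λ _ → ⇔.refl)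

    right : ∀ a b r s → FOSat (inner a b r s) (nearᶠ 5F 4F 2F 0F) ⇔ Near M X P b s
    right a b r s = nearᶠ-sound M {s = sets (inner a b r s)} {5F} {4F} {2F} {0F} (λ _ → ⇔.refl) (λ _ → ⇔.refl)

    forth : FOSat (⟦ M ⟧ ◂ X ◂ P) orderedᶠ → Orders X P
    forth h a b r s a∼r b∼s Pr Ps r<s
      with h a b r s (from (left a b r s) a∼r) (from (right a b r s) b∼s)
             (λ { _ refl → Pr }) (λ { _ refl → Ps }) (_ , _ , refl , refl , r<s)
    ... | _ , _ , refl , refl , a<b = a<b

    back : Orders X P → FOSat (⟦ M ⟧ ◂ X ◂ P) orderedᶠ
    back h a b r s a∼r b∼s Pr Ps (_ , _ , refl , refl , r<s) =
      _ , _ , refl , refl ,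
      h a b r s (to (left a b r s) a∼r) (to (right a b r s) b∼s) (Pr r refl) (Ps s refl) r<s

  classᶠ-sound : ∀ X P V C c → FOSat (⟦ M ⟧ ◂ X ◂ P ◂ V ◂ C ◂ ｛ c ｝) classᶠ ⇔ (∀ a → C a ⇔ Near M X P a c)
  classᶠ-sound X P V C c = mk⇔ forth back
    where
    outer : Position 5
    outer = ⟦ M ⟧ ◂ X ◂ P ◂ V ◂ C ◂ ｛ c ｝

    sound : ∀ a → FOSat (outer ◂ ｛ a ｝) (nearᶠ 5F 4F 0F 1F) ⇔ Near M X P a c
    sound a = nearᶠ-sound M {s = sets (outer ◂ ｛ a ｝)} {5F} {4F} {0F} {1F} (λ _ → ⇔.refl) (λ _ → ⇔.refl)

    forth : FOSat outer classᶠ → ∀ a → C a ⇔ Near M X P a c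
    forth h a = mk⇔ (λ Ca → to (sound a) (proj₁ (h a) (λ { _ refl → Ca })))
                    (λ a∼c → proj₂ (h a) (from (sound a) a∼c) a refl)

    back : (∀ a → C a ⇔ Near M X P a c) → FOSat outer classᶠ
    back h a = (λ Ca → from (sound a) (to (h a) (Ca a refl))) ,
               (λ a∼c → λ { _ refl → from (h a) (to (sound a) a∼c) })

-- The labelling `U` comes after `J` and `D`, so one decomposition can be examined under several
-- labellings; shuffles use one for each index.
record Decomposed (n : ℕ) (I : LinearOrder) (M : Carrier I → LinearOrder) (K : LinearOrder) : Set₁ where
  field
    J     : LinearOrder
    D     : Carrier J → LinearOrder
    ∑≅    : ∑ J D ≅ K
    label : ∀ U → ∃[ V ] (⟦ I ⟧ ◂ U ≈[ n ] ⟦ J ⟧ ◂ V) × (∀ j → ∃[ i ] (⟦ M i ⟧ ≈[ n ] ⟦ D j ⟧) × (U i ⇔ V j))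

  D-countable : Countable K → ∀ j → Countable (D j)
  D-countable K↣ℕ = summand-countable J D (≅-countable {K} {∑ J D} (≅-sym {∑ J D} {K} ∑≅) K↣ℕ)

  J-countable : Countable K → Countable J
  J-countable K↣ℕ = index-countable J D (≅-countable {K} {∑ J D} (≅-sym {∑ J D} {K} ∑≅) K↣ℕ)

  reassemble : (I≅J : I ≅ J) → (∀ i → M i ≅ D (Iso.fun {I} {J} I≅J i)) → ∑ I M ≅ K
  reassemble I≅J M≅D = ≅-trans {∑ I M} {∑ J D} {K} (∑-cong {I} {J} {M} {D} I≅J M≅D) ∑≅

module Decomposition (em : ∀ ℓ → ExcludedMiddle ℓ) where
  open Relativisation em

  -- Two rounds fix the colouring and the representatives, leaving the six that
  -- orderedᶠ needs; of these a label, a class and its representative use three and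
  -- classᶠ the other three.
  decompose : ∀ n I M {X} → Separates I X → ∀ K → ⟦ ∑ I M ⟧ ≈[ 8 ℕ.+ n ] ⟦ K ⟧ → Decomposed n I M K
  decompose n I M {X} separates K e = record
    { J = J ; D = D ; ∑≅ = ∑JD≅K ; label = λ U → Labels.V U , Labels.I≈J U , Labels.matched U }
    where
    A = ∑ I M
    module A = Restriction em A
    module K = Restriction em K
    open NearInSum I M X separates

    Y  = proj₁ (≈-forth e Coloured)
    e₁ = proj₂ (≈-forth e Coloured)
    Y-rep  = proj₁ (≈-forth e₁ Representative)
    e₂ = proj₂ (≈-forth e₁ Representative)

    cover : ∀ x → ∃[ q ] Y-rep q × Near K Y Y-rep x q
    cover = to (coverᶠ-sound K Y Y-rep) (FO-transfer coverᶠ (ℕ.m≤m+n 4 _) e₂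
      (from (coverᶠ-sound A Coloured Representative) ∼-cover))

    ordered : ∀ x y q r → Near K Y Y-rep x q → Near K Y Y-rep y r → Y-rep q → Y-rep r →
              Order._<_ K q r → Order._<_ K x y
    ordered = to (orderedᶠ-sound K Y Y-rep) (FO-transfer orderedᶠ (ℕ.m≤m+n 6 _) e₂
      (from (orderedᶠ-sound A Coloured Representative) λ a b r s → ∼-ordered {a} {b} {r} {s}))

    q₀ : ∃ Y-rep
    q₀ = let q , Qq , _ = cover (Order.inhabited K) in q , Qq

    J : LinearOrder
    J = K ↾ q₀

    Class : Carrier J → Pred (Carrier K) 0ℓ
    Class j x = Near K Y Y-rep x (elem j)

    class : ∀ j → ∃ (Class j)
    class j = elem j , NearProperties.near-refl K Y Y-rep (elem j)

    D : Carrier J → LinearOrder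
    D j = K ↾ class j

    ∑JD≅K : ∑ J D ≅ K
    ∑JD≅K = ≅-trans {∑ J D} {K ↾ all} {K}
      (K.glue J Class class all (λ _ _ → _) (λ {x} _ → let q , Qq , x∼q = cover x in (q ∣ Qq) , x∼q)
        λ {i} {j} {x} {y} i<j x∼i y∼j → ordered x y (elem i) (elem j) x∼i y∼j (K.member i) (K.member j) i<j)
      (K.↾-U all _)
      where
      all : ∃ U
      all = Order.inhabited K , _

    summand : ∀ {C} i (c : ∃ C) → (∀ a → C a ⇔ i ≡ proj₁ a) → M i ≅ A ↾ c
    summand {C} i c C⇔ = ≅-intro {M i} {A ↾ c} (λ x → (i , x) ∣ from (C⇔ (i , x)) refl) OrderedSum.within surj
      where
      surj : ∀ y → ∃[ x ] (((i , x) ∣ from (C⇔ (i , x)) refl) ≡ y)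
      surj y with elem y in eq | to (C⇔ (elem y)) (A.member y)
      ... | _ , x | refl = x , Sub-≡ (sym eq)

    module Labels (U : Pred (Carrier I) 0ℓ) where
      -- The label of a summand is put on its representative only. The representatives form a copy
      -- of `I` on one side and are `J` on the other, so relativising to them compares the labelled
      -- index orders.
      Û V̂ : _
      Û (i , x) = LinearOrder.inhabited (M i) ≡ x × U i
      V̂ = proj₁ (≈-forth e₂ Û)
      e₃ = proj₂ (≈-forth e₂ Û)

      V : Pred (Carrier J) 0ℓ
      V j = V̂ (elem j)

      I≈J : ⟦ I ⟧ ◂ U ≈[ n ] ⟦ J ⟧ ◂ V
      I≈J = ≈-trans (≈-iso n {I} {A ↾ r₀} I≅R λ { 0F i → mk⇔ (refl ,_) proj₂ })
        (≈-trans (≈-mono (ℕ.m≤n+m n 5) (≈-↾ e₃ 1F (λ _ → 0F) (λ _ → proj₁) r₀ q₀))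
          (≈-resp n J λ { 0F _ → ⇔.refl }))
        where
        r₀ : ∃ Representative
        r₀ = (Order.inhabited I , _) , refl
        surj : ∀ (y : Carrier (A ↾ r₀)) → ∃[ i ] ((i , LinearOrder.inhabited (M i)) ∣ refl) ≡ y
        surj y = proj₁ (elem y) , Sub-≡ (cong (_ ,_) (A.member y))
        I≅R : I ≅ A ↾ r₀
        I≅R = ≅-intro {I} {A ↾ r₀} (λ i → (i , _) ∣ refl) OrderedSum.across surj

      matched : ∀ j → ∃[ i ] (⟦ M i ⟧ ≈[ n ] ⟦ D j ⟧) × (U i ⇔ V j)
      matched j = i , M≈D , U⇔V
        where
        -- Spoiler plays the piece at `j` and then its representative. The replies are a summand and
        -- its representative, and restricting the game to piece and summand shows these equivalent.
        C  = proj₁ (≈-back e₃ (Class j))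
        e₄ = proj₂ (≈-back e₃ (Class j))
        c  = proj₁ (≈-point e₄ (elem j))
        e₅ = proj₂ (≈-point e₄ (elem j))
        i  = proj₁ c

        c-representative : Representative c
        c-representative = from (≈⇒atoms e₅ (0F ⊆̇ 3F)) (λ { _ refl → K.member j }) c refl

        U⇔V : U i ⇔ V j
        U⇔V = mk⇔
          (λ Ui → to (≈⇒atoms e₅ (0F ⊆̇ 2F)) (λ { _ refl → c-representative , Ui }) (elem j) refl)
          (λ Vj → proj₂ (from (≈⇒atoms e₅ (0F ⊆̇ 2F)) (λ { _ refl → Vj }) c refl))

        C-near : ∀ a → C a ⇔ (a ∼ c)
        C-near = to (classᶠ-sound A Coloured Representative Û C c)
          (FO-transfer classᶠ (ℕ.m≤m+n 3 n) (≈-sym e₅)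
            (from (classᶠ-sound K Y Y-rep V̂ (Class j) (elem j)) λ _ → ⇔.refl))

        C⇔ : ∀ a → C a ⇔ i ≡ proj₁ a
        C⇔ a = mk⇔ (λ Ca → sym (∼⇒≡ {a} {c} (to (C-near a) Ca))) (λ eq → from (C-near a) (≡⇒∼ {a} {c} (sym eq)))

        c₀ : ∃ C
        c₀ = c , from (C⇔ c) refl

        M≈D : ⟦ M i ⟧ ≈[ n ] ⟦ D j ⟧
        M≈D = ≈-trans (≈-iso n {M i} {A ↾ c₀} (summand i c₀ C⇔) λ ())
          (≈-trans (≈-mono (ℕ.m≤n+m n 3) (≈-↾ e₅ 1F Vec.[] (λ ()) c₀ (class j)))
            (≈-resp n (D j) λ ()))

-- Rigidity of the members of 𝕄

Rigid : LinearOrder → Set₁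
Rigid M = ∃[ n ] ∀ K → Countable K → ⟦ M ⟧ ≈[ n ] ⟦ K ⟧ → M ≅ K

op-op : ∀ M → M ᵒᵖ ᵒᵖ ≅ M
op-op M = ≅-intro {M ᵒᵖ ᵒᵖ} {M} id id λ x → x , refl

rigid-≅ : ∀ {M N} → M ≅ N → Rigid M → Rigid N
rigid-≅ {M} {N} M≅N (n , r) = n , λ K K↣ℕ e →
  ≅-trans {N} {M} {K} (≅-sym {M} {N} M≅N) (r K K↣ℕ (≈-trans (≈-iso n {M} {N} M≅N λ ()) e))

rigid-op : ∀ {M} → Rigid M → Rigid (M ᵒᵖ)
rigid-op {M} (n , r) = n , λ K K↣ℕ e →
  ≅-trans {M ᵒᵖ} {K ᵒᵖ ᵒᵖ} {K}
    (op-≅ {M} {K ᵒᵖ} (r (K ᵒᵖ) K↣ℕ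
      (≈-trans (≈-iso n {M} {M ᵒᵖ ᵒᵖ} (≅-sym {M ᵒᵖ ᵒᵖ} {M} (op-op M)) λ ()) (≈-op e))))
    (op-op K)

rigid-at : ∀ {M m n K} → (∀ K → Countable K → ⟦ M ⟧ ≈[ m ] ⟦ K ⟧ → M ≅ K) → m ℕ.≤ n →
           Countable K → ⟦ M ⟧ ≈[ n ] ⟦ K ⟧ → M ≅ K
rigid-at r m≤n K↣ℕ e = r _ K↣ℕ (≈-mono m≤n e)

-- First-order properties that pin down the index orders

successorᶠ initialᶠ closedᶠ fullᶠ : ∀ {p} → FO (suc p)
initialᶠ   = ∃ᶠ (∀ᶠ (atom (0F <̇ 1F) ⇒ ⊥̇))
successorᶠ = ∀ᶠ (∃ᶠ (atom (1F <̇ 0F) ∧ ∀ᶠ (atom (2F <̇ 0F) ⇒ atom (0F <̇ 1F) ⇒ ⊥̇)))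
closedᶠ    = ∀ᶠ (∀ᶠ (atom (0F <̇ 1F) ⇒ ⊥̇) ⇒ atom (0F ⊆̇ 1F)) ∧
             ∀ᶠ (∀ᶠ (atom (1F <̇ 0F) ⇒ ∀ᶠ (atom (2F <̇ 0F) ⇒ atom (0F <̇ 1F) ⇒ ⊥̇) ⇒
                     atom (1F ⊆̇ 2F) ⇒ atom (0F ⊆̇ 2F)))
fullᶠ      = ∀ᶠ (atom (0F ⊆̇ 1F))

splitᶠ unboundedᶠ denseᶠ : ∀ {p} → FO (suc p)
splitᶠ     = ∃ᶠ (∃ᶠ (atom (1F <̇ 0F) ∧ atom (1F ⊆̇ 2F) ∧ (atom (0F ⊆̇ 2F) ⇒ ⊥̇) ∧
             ∀ᶠ ((atom (0F ⊆̇ 3F) ⇒ atom (0F ⊆̇ 2F)) ∧ ((atom (0F ⊆̇ 3F) ⇒ ⊥̇) ⇒ atom (0F ⊆̇ 1F)))))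
unboundedᶠ = ∀ᶠ (∃ᶠ (atom (1F <̇ 0F))) ∧ ∀ᶠ (∃ᶠ (atom (0F <̇ 1F)))
denseᶠ     = ∀ᶠ (∀ᶠ (atom (1F <̇ 0F) ⇒ ∃ᶠ (atom (0F ⊆̇ 3F) ∧ atom (2F <̇ 0F) ∧ atom (0F <̇ 1F))))

module _ {p} (P : Position (suc p)) where
  private
    M = order P
    Z = sets P 0F
  open Order M

  Initial : Pred (Carrier M) 0ℓ
  Initial a = ∀ b → a ≤ b

  _⋖_ : Carrier M → Carrier M → Set
  a ⋖ b = a < b × (∀ c → a < c → b ≤ c)

  Split : Set
  Split = ∃₂ λ a b → a < b × Z a × ¬ Z b × (∀ c → (Z c → a ≡ c) × (¬ Z c → b ≡ c))

  splitᶠ-sound : FOSat P splitᶠ ⇔ Split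
  splitᶠ-sound = mk⇔ forth back
    where
    forth : FOSat P splitᶠ → Split
    forth (a , b , (_ , _ , refl , refl , a<b) , Za , ¬Zb , rest) =
      a , b , a<b , Za a refl , (λ Zb → ¬Zb λ { _ refl → Zb }) ,
      λ c → (λ Zc → proj₁ (rest c) (λ { _ refl → Zc }) c refl) ,
            (λ ¬Zc → proj₂ (rest c) (λ h → ¬Zc (h c refl)) c refl)
    back : Split → FOSat P splitᶠ
    back (a , b , a<b , Za , ¬Zb , rest) =
      a , b , (_ , _ , refl , refl , a<b) , (λ { _ refl → Za }) , (λ h → ¬Zb (h b refl)) ,
      λ c → (λ h → λ { _ refl → proj₁ (rest c) (h c refl) }) ,
            (λ h → λ { _ refl → proj₂ (rest c) (λ Zc → h λ { _ refl → Zc }) })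

  initialᶠ-sound : FOSat P initialᶠ ⇔ ∃ Initial
  initialᶠ-sound = mk⇔ forth back
    where
    forth : FOSat P initialᶠ → ∃ Initial
    forth (a , least) = a , λ b b<a → least b (_ , _ , refl , refl , b<a)
    back : ∃ Initial → FOSat P initialᶠ
    back (a , least) = a , λ { b (_ , _ , refl , refl , b<a) → least b b<a }

  successorᶠ-sound : FOSat P successorᶠ ⇔ (∀ a → ∃[ b ] a ⋖ b)
  successorᶠ-sound = mk⇔ forth back
    where
    forth : FOSat P successorᶠ → ∀ a → ∃[ b ] a ⋖ b
    forth h a with h a
    ... | b , (_ , _ , refl , refl , a<b) , cover =
      b , a<b , λ c a<c c<b → cover c (_ , _ , refl , refl , a<c) (_ , _ , refl , refl , c<b)
    back : (∀ a → ∃[ b ] a ⋖ b) → FOSat P successorᶠ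
    back h a = let b , a<b , cover = h a in b , (_ , _ , refl , refl , a<b) ,
      λ { c (_ , _ , refl , refl , a<c) (_ , _ , refl , refl , c<b) → cover c a<c c<b }

  Closed : Set
  Closed = (∀ a → Initial a → Z a) × (∀ a b → a ⋖ b → Z a → Z b)

  closedᶠ-sound : FOSat P closedᶠ ⇔ Closed
  closedᶠ-sound = mk⇔ forth back
    where
    forth : FOSat P closedᶠ → Closed
    forth (h , k) =
      (λ a initial → h a (λ { b (_ , _ , refl , refl , b<a) → initial b b<a }) a refl) ,
      λ a b (a<b , cover) Za → k a b (_ , _ , refl , refl , a<b)
        (λ { c (_ , _ , refl , refl , a<c) (_ , _ , refl , refl , c<b) → cover c a<c c<b })
        (λ { _ refl → Za }) b refl
    back : Closed → FOSat P closedᶠ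
    back (h , k) =
      (λ { a initial _ refl → h a λ b b<a → initial b (_ , _ , refl , refl , b<a) }) ,
      λ { a b (_ , _ , refl , refl , a<b) cover Za _ refl →
        k a b (a<b , λ c a<c c<b → cover c (_ , _ , refl , refl , a<c) (_ , _ , refl , refl , c<b)) (Za a refl) }

  DenseSet : Set
  DenseSet = ∀ {a b} → a < b → ∃[ c ] Z c × a < c × c < b

  unboundedᶠ-sound : FOSat P unboundedᶠ ⇔ Unbounded M
  unboundedᶠ-sound = mk⇔ forth back
    where
    forth : FOSat P unboundedᶠ → Unbounded M
    forth (h , k) .Unbounded.above a with h a
    ... | b , _ , _ , refl , refl , a<b = b , a<b
    forth (h , k) .Unbounded.below a with k a
    ... | b , _ , _ , refl , refl , b<a = b , b<a
    back : Unbounded M → FOSat P unboundedᶠ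
    back u = (λ a → let b , a<b = above a in b , _ , _ , refl , refl , a<b) ,
             (λ a → let b , b<a = below a in b , _ , _ , refl , refl , b<a)
      where open Unbounded u

  denseᶠ-sound : FOSat P denseᶠ ⇔ DenseSet
  denseᶠ-sound = mk⇔ forth back
    where
    forth : FOSat P denseᶠ → DenseSet
    forth h {a} {b} a<b with h a b (_ , _ , refl , refl , a<b)
    ... | c , Zc , (_ , _ , refl , refl , a<c) , (_ , _ , refl , refl , c<b) = c , Zc c refl , a<c , c<b
    back : DenseSet → FOSat P denseᶠ
    back h a b (_ , _ , refl , refl , a<b) =
      let c , Zc , a<c , c<b = h a<b
      in c , (λ { _ refl → Zc }) , (_ , _ , refl , refl , a<c) , (_ , _ , refl , refl , c<b)

bound : ∀ {n} (f : Fin n → ℕ) → ∃[ b ] ∀ i → f i ℕ.≤ b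
bound {zero}  f = 0 , λ ()
bound {suc n} f = let b , f≤b = bound (f ∘ suc) in f 0F ⊔ b , λ
  { 0F → ℕ.m≤m⊔n (f 0F) b ; (suc i) → ℕ.≤-trans (f≤b i) (ℕ.m≤n⊔m (f 0F) b) }

module Rigidity (em : ∀ ℓ → ExcludedMiddle ℓ) where
  open Decomposition em
  open BackAndForth em

  rigid-𝟏 : Rigid 𝟏
  -- Two rounds, for the two quantifiers saying that all points coincide.
  rigid-𝟏 = 2 , λ K _ e →
    let unique = FO-transfer (∀ᶠ (∀ᶠ (atom (1F ⊆̇ 0F)))) (s≤s (s≤s z≤n)) e λ { 0F 0F 0F refl → refl }
        x = LinearOrder.inhabited K
    in ≅-intro {𝟏} {K} (const x) (λ { {0F} {0F} () }) λ y → 0F , sym (unique x y x refl)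

  -- A decomposition only makes each piece equivalent to some summand. Labelling the lower index
  -- decides to which one.
  rigid-⊕ : ∀ {M N} → Rigid M → Rigid N → Rigid (M ⊕ N)
  rigid-⊕ {M} {N} (m , rM) (n , rN) = 8 ℕ.+ l , λ K K↣ℕ e → result K K↣ℕ (decompose l 𝟐 F separates K e)
    where
    -- Three rounds for `splitᶠ`, and enough to apply the rigidity of both summands.
    l = 3 ℕ.+ (m ⊔ n)
    F : Bool → LinearOrder
    F b = if b then N else M

    separates : Separates 𝟐 ｛ true ｝
    separates f<t = inj₁ (true , false , ((λ ()) , (λ ())) , ((λ ()) , (λ ())) , refl , λ ())

    𝟐-split : FOSat (⟦ 𝟐 ⟧ ◂ ｛ false ｝) splitᶠ
    𝟐-split = from (splitᶠ-sound (⟦ 𝟐 ⟧ ◂ ｛ false ｝)) (false , true , f<t , refl , (λ ()) , λ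
      { false → id , (λ h → contradiction refl h) ; true → (λ ()) , λ _ → refl })

    result : ∀ K → Countable K → Decomposed l 𝟐 F K → M ⊕ N ≅ K
    result K K↣ℕ d = conclude (to (splitᶠ-sound (⟦ J ⟧ ◂ V)) (FO-transfer splitᶠ (ℕ.m≤m+n 3 _) 𝟐≈J 𝟐-split))
      where
      open Decomposed d
      V = proj₁ (label ｛ false ｝)
      𝟐≈J = proj₁ (proj₂ (label ｛ false ｝))
      match = proj₂ (proj₂ (label ｛ false ｝))

      conclude : Split (⟦ J ⟧ ◂ V) → M ⊕ N ≅ K
      conclude (a , b , a<b , Va , ¬Vb , rest) = reassemble (≅-intro {𝟐} {J} g (λ { f<t → a<b }) g-surj) g-≅
        where
        g : Bool → Carrier J
        g false = a
        g true  = b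

        g-surj : ∀ j → ∃[ c ] g c ≡ j
        g-surj j with em 0ℓ {V j}
        ... | yes Vj = false , proj₁ (rest j) Vj
        ... | no ¬Vj = true , proj₂ (rest j) ¬Vj

        g-≅ : ∀ c → F c ≅ D (g c)
        g-≅ false with match a
        ... | false , M≈D , _   = rigid-at {M} rM (ℕ.≤-trans (ℕ.m≤m⊔n m n) (ℕ.m≤n+m _ 3)) (D-countable K↣ℕ a) M≈D
        ... | true  , _   , U⇔V = contradiction (from U⇔V Va) λ ()
        g-≅ true with match b
        ... | true  , N≈D , _   = rigid-at {N} rN (ℕ.≤-trans (ℕ.m≤n⊔m m n) (ℕ.m≤n+m _ 3)) (D-countable K↣ℕ b) N≈D
        ... | false , _   , U⇔V = contradiction (to U⇔V refl) ¬Vb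

  even : ℕ → Bool
  even zero    = true
  even (suc k) = not (even k)

  -- If `i < j` then `i` and `suc i` both lie in the closed interval and differ in parity.
  even-separates : Separates ω (λ k → even k ≡ true)
  even-separates {i} {j} i<j with even i in eq
  ... | true  = inj₁ (i , suc i , (ℕ.<-irrefl refl , ℕ.<-asym i<j) , (ℕ.<-asym ℕ.≤-refl , ℕ.≤⇒≯ i<j) ,
                      eq , λ h → contradiction (trans (sym (cong not eq)) h) λ ())
  ... | false = inj₁ (suc i , i , (ℕ.<-asym ℕ.≤-refl , ℕ.≤⇒≯ i<j) , (ℕ.<-irrefl refl , ℕ.<-asym i<j) ,
                      cong not eq , λ h → contradiction (trans (sym eq) h) λ ())

  -- Induction is tested on one set, the iterated successors of the least element of `J`. The set
  -- answering it in ω is closed as well, hence full, and fullness transfers back. One round is for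
  -- this set, three are for `closedᶠ`.
  ω-rigid : ∀ J {U V} → ⟦ ω ⟧ ◂ U ≈[ 4 ] ⟦ J ⟧ ◂ V → ω ≅ J
  ω-rigid J {U} {V} e = ≅-intro {ω} {J} f f-mono λ j → full j j refl
    where
    open Order J

    initial : ∃ (Initial (⟦ J ⟧ ◂ V))
    initial = to (initialᶠ-sound (⟦ J ⟧ ◂ V)) (FO-transfer initialᶠ (s≤s (s≤s z≤n)) e
      (from (initialᶠ-sound (⟦ ω ⟧ ◂ U)) (0 , λ _ ())))

    successor : ∀ j → ∃ (_⋖_ (⟦ J ⟧ ◂ V) j)
    successor = to (successorᶠ-sound (⟦ J ⟧ ◂ V)) (FO-transfer successorᶠ (s≤s (s≤s (s≤s z≤n))) e
      (from (successorᶠ-sound (⟦ ω ⟧ ◂ U)) λ k → suc k , ℕ.≤-refl , λ _ → ℕ.≤⇒≯))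

    f : ℕ → Carrier J
    f zero    = proj₁ initial
    f (suc k) = proj₁ (successor (f k))

    f-mono : ∀ {k l} → k ℕ.< l → f k < f l
    f-mono k<l = go (ℕ.≤⇒≤′ k<l)
      where
      go : ∀ {k l} → suc k ℕ.≤′ l → f k < f l
      go {k} ℕ.≤′-refl                = proj₁ (proj₂ (successor (f k)))
      go     (ℕ.≤′-step {n = l} k<′l) = <-trans (go k<′l) (proj₁ (proj₂ (successor (f l))))

    Image : Pred (Carrier J) 0ℓ
    Image j = ∃[ k ] f k ≡ j

    image-closed : Closed (⟦ J ⟧ ◂ V ◂ Image)
    image-closed =
      (λ j least → 0 , ≤-antisym (proj₂ initial j) (least (f 0))) ,
      λ { _ j (fk<j , cover) (k , refl) → suc k , ≤-antisym (proj₂ (proj₂ (successor (f k))) j fk<j)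
                                                            (cover (f (suc k)) (f-mono {k} ℕ.≤-refl)) }

    Z  = proj₁ (≈-back e Image)
    e′ = proj₂ (≈-back e Image)

    Z-closed : Closed (⟦ ω ⟧ ◂ U ◂ Z)
    Z-closed = to (closedᶠ-sound (⟦ ω ⟧ ◂ U ◂ Z)) (FO-transfer closedᶠ ℕ.≤-refl (≈-sym e′)
      (from (closedᶠ-sound (⟦ J ⟧ ◂ V ◂ Image)) image-closed))

    Z-full : ∀ k → Z k
    Z-full zero    = proj₁ Z-closed 0 λ _ ()
    Z-full (suc k) = proj₂ Z-closed k (suc k) (ℕ.≤-refl , λ _ → ℕ.≤⇒≯) (Z-full k)

    full : ∀ j → ∀ i → j ≡ i → Image i
    full = FO-transfer fullᶠ (s≤s z≤n) e′ λ { k _ refl → Z-full k }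

  rigid-ω : ∀ {M} → Rigid M → Rigid (M · ω)
  rigid-ω {M} (m , r) = 8 ℕ.+ (4 ℕ.+ m) , λ K K↣ℕ e →
    result K K↣ℕ (decompose (4 ℕ.+ m) ω (const M) even-separates K e)
    where
    result : ∀ K → Countable K → Decomposed (4 ℕ.+ m) ω (const M) K → M · ω ≅ K
    result K K↣ℕ d = reassemble ω≅J λ k → M≅D (Iso.fun {ω} {J} ω≅J k)
      where
      open Decomposed d

      ω≅J : ω ≅ J
      ω≅J = ω-rigid J (≈-mono (ℕ.m≤m+n 4 m) (proj₁ (proj₂ (label U))))

      M≅D : ∀ j → M ≅ D j
      M≅D j = let _ , M≈D , _ = proj₂ (proj₂ (label U)) j in
        rigid-at {M} r (ℕ.m≤n+m m 4) (D-countable K↣ℕ j) M≈D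

  -- The order `M · ω ᵒᵖ` is the reverse of `M ᵒᵖ · ω`, and rigidity is invariant under reversal.
  rigid-ω* : ∀ {M} → Rigid M → Rigid (M · ω ᵒᵖ)
  rigid-ω* {M} r = rigid-≅ {(M ᵒᵖ · ω) ᵒᵖ} {M · ω ᵒᵖ}
    (≅-trans {(M ᵒᵖ · ω) ᵒᵖ} {M ᵒᵖ ᵒᵖ · ω ᵒᵖ} {M · ω ᵒᵖ} (op-· (M ᵒᵖ) ω)
      (∑-cong {ω ᵒᵖ} {ω ᵒᵖ} (≅-refl {ω ᵒᵖ}) λ _ → op-op M))
    (rigid-op {M ᵒᵖ · ω} (rigid-ω {M ᵒᵖ} (rigid-op {M} r)))

  -- A label is a single set, so each index `i` gets its own, marking the rationals that carry
  -- `M i`. Its counterpart is dense in `J` by `denseᶠ`, whence the three rounds, and the pieces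
  -- there are isomorphic to `M i` because `b` bounds all the ranks of rigidity. Back and forth then
  -- matches `a` with `j` when `Mₐ a ≅ D j`.
  rigid-shuffle : ∀ {n} {M : Fin (suc n) → LinearOrder} {Mₐ} →
                  (∀ i → Rigid (M i)) → IsShuffleOf M Mₐ → Rigid (∑ η Mₐ)
  rigid-shuffle {n} {M} {Mₐ} rigid sh = 8 ℕ.+ l , λ K K↣ℕ e → result K K↣ℕ (decompose l η Mₐ separates K e)
    where
    open IsShuffleOf sh
    b = proj₁ (bound (proj₁ ∘ rigid))
    l = 3 ℕ.+ b

    separates : Separates η U
    separates i<j = let k , i<k , k<j = ℚ.<-dense i<j ; l , k<l , l<j = ℚ.<-dense k<j in
      inj₂ (k , l , i<k , k<l , l<j)

    result : ∀ K → Countable K → Decomposed l η Mₐ K → ∑ η Mₐ ≅ K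
    result K K↣ℕ d = reassemble (proj₁ iso′) (proj₂ iso′)
      where
      open Decomposed d
      Like : Fin (suc n) → Pred ℚ 0ℓ
      Like i a = Mₐ a ≅ M i

      V : Fin (suc n) → Pred (Carrier J) 0ℓ
      V i = proj₁ (label (Like i))

      η≈J : ∀ i → ⟦ η ⟧ ◂ Like i ≈[ 3 ] ⟦ J ⟧ ◂ V i
      η≈J i = ≈-mono (ℕ.m≤m+n 3 b) (proj₁ (proj₂ (label (Like i))))

      J-unbounded : Unbounded J
      J-unbounded = to (unboundedᶠ-sound (⟦ J ⟧ ◂ V 0F)) (FO-transfer unboundedᶠ (s≤s (s≤s z≤n)) (η≈J 0F)
        (from (unboundedᶠ-sound (⟦ η ⟧ ◂ Like 0F)) η-unbounded))

      V-dense : ∀ i → DenseSet (⟦ J ⟧ ◂ V i)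
      V-dense i = to (denseᶠ-sound (⟦ J ⟧ ◂ V i)) (FO-transfer denseᶠ ℕ.≤-refl (η≈J i)
        (from (denseᶠ-sound (⟦ η ⟧ ◂ Like i)) (dense i)))

      ≈⇒≅ : ∀ {i a j} → Mₐ a ≅ M i → ⟦ Mₐ a ⟧ ≈[ l ] ⟦ D j ⟧ → M i ≅ D j
      ≈⇒≅ {i} {a} {j} Mₐ≅M Mₐ≈D = rigid-at {M i} (proj₂ (rigid i))
        (ℕ.≤-trans (proj₂ (bound (proj₁ ∘ rigid)) i) (ℕ.m≤n+m b 3)) (D-countable K↣ℕ j)
        (≈-trans (≈-iso l {M i} {Mₐ a} (≅-sym {Mₐ a} {M i} Mₐ≅M) λ ()) Mₐ≈D)

      V⇒≅ : ∀ i j → V i j → M i ≅ D j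
      V⇒≅ i j Vj = let a , Mₐ≈D , U⇔V = proj₂ (proj₂ (label (Like i))) j in ≈⇒≅ {i} {a} {j} (from U⇔V Vj) Mₐ≈D

      fillJ : ∀ a {j j′} → Order._<_ J j j′ → ∃[ k ] Mₐ a ≅ D k × Order._<_ J j k × Order._<_ J k j′
      fillJ a j<j′ =
        let i , Mₐ≅M = covered a
            k , Vk , j<k , k<j′ = V-dense i j<j′
        in k , ≅-trans {Mₐ a} {M i} {D k} Mₐ≅M (V⇒≅ i k Vk) , j<k , k<j′

      fillη : ∀ j {p q} → p ℚ.< q → ∃[ r ] Mₐ r ≅ D j × p ℚ.< r × r ℚ.< q
      fillη j p<q =
        let a , Mₐ≈D , _ = proj₂ (proj₂ (label U)) j
            i , Mₐ≅M = covered a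
            r , Mᵣ≅M , p<r , r<q = dense i p<q
        in r , ≅-trans {Mₐ r} {M i} {D j} Mᵣ≅M (≈⇒≅ {i} {a} {j} Mₐ≅M Mₐ≈D) , p<r , r<q

      iso′ : ∃[ η≅J ] ∀ a → Mₐ a ≅ D (Iso.fun {η} {J} η≅J a)
      iso′ = backAndForth η J η-countable (J-countable K↣ℕ) η-unbounded J-unbounded
        (λ a j → Mₐ a ≅ D j) fillJ fillη

  𝕄⇒rigid : ∀ {M} → M ∈ 𝕄 → Rigid M
  𝕄⇒rigid one                     = rigid-𝟏
  𝕄⇒rigid (sum {M} {N} m n)       = rigid-⊕ {M} {N} (𝕄⇒rigid m) (𝕄⇒rigid n)
  𝕄⇒rigid (times-ω {M} m)         = rigid-ω {M} (𝕄⇒rigid m)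
  𝕄⇒rigid (times-ω* {M} m)        = rigid-ω* {M} (𝕄⇒rigid m)
  𝕄⇒rigid (shuffle {M = M} m s)   = rigid-shuffle {M = M} (λ i → 𝕄⇒rigid (m i)) s
  𝕄⇒rigid (iso {M} {N} M≅N m)     = rigid-≅ {M} {N} M≅N (𝕄⇒rigid m)

  open FiniteIndex em

  𝕄⇒categorical : ∀ {M} → M ∈ 𝕄 → ∃[ ψ ] M ⊨ ψ × Categorical≤ℵ₀ ψ
  𝕄⇒categorical {M} m =
    let n , rigid = 𝕄⇒rigid m
        ψ , Mψ , ψ⇒≈ = characteristic n M
    in ψ , Mψ , λ K L K↣ℕ L↣ℕ Kψ Lψ →
      ≅-trans {K} {M} {L} (≅-sym {M} {K} (rigid K K↣ℕ (ψ⇒≈ K Kψ))) (rigid L L↣ℕ (ψ⇒≈ L Lψ))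

-- Monochromatic paths and cofinal sequences

module Classical (em : ∀ ℓ → ExcludedMiddle ℓ) where
  stable : ∀ {ℓ} {P : Set ℓ} → ¬ ¬ P → P
  stable {ℓ} = decidable-stable (em ℓ)

  ¬∀⇒∃¬ : ∀ {a b} {A : Set a} {P : A → Set b} → ¬ (∀ x → P x) → ∃[ x ] ¬ P x
  ¬∀⇒∃¬ ¬∀ = stable λ ¬∃ → ¬∀ λ x → stable λ ¬Px → ¬∃ (x , ¬Px)

  UnboundedIn-ℕ : Pred ℕ 0ℓ → Set
  UnboundedIn-ℕ A = ∀ k → ∃[ i ] k ℕ.< i × A i

  -- The weak form of Ramsey's theorem that is needed: an infinite path whose
  -- consecutive edges, rather than all edges, share a colour.
  MonochromaticPath : (ℕ → ℕ → ℕ) → Set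
  MonochromaticPath c = Σ (ℕ → ℕ) λ g → Σ ℕ λ t → (∀ k → g k ℕ.< g (suc k)) × (∀ k → c (g k) (g (suc k)) ≡ t)

  -- Induction on the number of colours. If unboundedly many points of `A` start no edge of the last
  -- colour inside `A`, those points use one colour fewer. Otherwise every point of `A` past some
  -- bound starts such an edge, and these edges can be followed for ever.
  monochromaticPath-in : ∀ m c A → UnboundedIn-ℕ A → (∀ {i j} → A i → A j → i ℕ.< j → c i j ℕ.< m) →
                         MonochromaticPath c
  monochromaticPath-in zero c A unb c<m =
    let i , _ , Ai = unb 0 ; j , i<j , Aj = unb i in contradiction (c<m Ai Aj i<j) λ ()
  monochromaticPath-in (suc m) c A unb c<m = split (em 0ℓ)
    where
    Avoids : Pred ℕ 0ℓ
    Avoids i = A i × (∀ {j} → A j → i ℕ.< j → ¬ c i j ≡ m)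

    split : Dec (UnboundedIn-ℕ Avoids) → MonochromaticPath c
    split (yes unb′) = monochromaticPath-in m c Avoids unb′ λ (Ai , avoids) (Aj , _) i<j →
      ℕ.≤∧≢⇒< (ℕ.≤-pred (c<m Ai Aj i<j)) (avoids Aj i<j)
    split (no ¬unb′) = (proj₁ ∘ path) , m , (λ k → proj₁ (proj₂ (next (path k)))) ,
      λ k → proj₂ (proj₂ (next (path k)))
      where
      b = proj₁ (¬∀⇒∃¬ ¬unb′)

      Late : Pred ℕ 0ℓ
      Late i = b ℕ.< i × A i

      next : (i : ∃ Late) → Σ (∃ Late) λ j → proj₁ i ℕ.< proj₁ j × c (proj₁ i) (proj₁ j) ≡ m
      next (i , b<i , Ai) = stable λ none → proj₂ (¬∀⇒∃¬ ¬unb′)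
        (i , b<i , Ai , λ {j} Aj i<j eq → none ((j , ℕ.<-trans b<i i<j , Aj) , i<j , eq))

      path : ℕ → ∃ Late
      path zero    = unb b
      path (suc k) = proj₁ (next (path k))

  monochromaticPath : ∀ m c → (∀ i j → c i j ℕ.< m) → MonochromaticPath c
  monochromaticPath m c c<m = monochromaticPath-in m c U (λ k → suc k , ℕ.≤-refl , _) λ {i} {j} _ _ _ → c<m i j

  minimal : ∀ {A : Set} (f : A → ℕ) {P : Pred A 0ℓ} → ∃ P → ∃[ a ] P a × (∀ b → P b → f a ℕ.≤ f b)
  minimal {A} f {P} (a , Pa) = go (suc (f a)) a Pa ℕ.≤-refl
    where
    go : ∀ k a → P a → f a ℕ.< k → ∃[ a ] P a × (∀ b → P b → f a ℕ.≤ f b)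
    go (suc k) a Pa fa<k with em 0ℓ {∃[ b ] P b × f b ℕ.< f a}
    ... | yes (b , Pb , fb<fa) = go k b Pb (ℕ.<-≤-trans fb<fa (ℕ.≤-pred fa<k))
    ... | no none = a , Pa , λ b Pb → ℕ.≮⇒≥ λ fb<fa → none (b , Pb , fb<fa)

  -- The field `start` is an inequality because thinning to a subsequence may drop the first terms.
  record CofinalSequence (M : LinearOrder) (S : Pred (Carrier M) 0ℓ) (p : Carrier M) : Set where
    open Order M
    field
      term       : ℕ → Carrier M
      start      : p ≤ term 0
      inside     : ∀ k → S (term k)
      increasing : ∀ k → term k < term (suc k)
      cofinal    : ∀ {x} → S x → ∃[ k ] x < term k

    strictly-monotone : ∀ {k l} → k ℕ.< l → term k < term l
    strictly-monotone k<l = go (ℕ.≤⇒≤′ k<l)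
      where
      go : ∀ {k l} → suc k ℕ.≤′ l → term k < term l
      go {k} ℕ.≤′-refl                = increasing k
      go     (ℕ.≤′-step {n = l} k<′l) = <-trans (go k<′l) (increasing l)

    monotone : ∀ {k l} → k ℕ.≤ l → term k ≤ term l
    monotone k≤l with ℕ.m≤n⇒m<n∨m≡n k≤l
    ... | inj₁ k<l  = asym (strictly-monotone k<l)
    ... | inj₂ refl = ≤-refl

    bracket-≤< : ∀ {x} → S x → term 0 ≤ x → ∃[ k ] term k ≤ x × x < term (suc k)
    bracket-≤< {x} Sx 0≤x = let k , x<k = cofinal Sx in go k x<k
      where
      go : ∀ k → x < term k → ∃[ k ] term k ≤ x × x < term (suc k)
      go zero    x<0 = contradiction x<0 0≤x
      go (suc k) x<k with <⊎≥ x (term k)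
      ... | inj₁ x< = go k x<
      ... | inj₂ ≤x = k , ≤x , x<k

    -- Reversal turns left-closed intervals into right-closed ones; this form is for descending
    -- sequences, which are sequences in the reversed order.
    bracket-<≤ : ∀ {x} → S x → term 0 < x → ∃[ k ] term k < x × x ≤ term (suc k)
    bracket-<≤ {x} Sx 0<x = let k , x<k = cofinal Sx in go k (asym x<k)
      where
      go : ∀ k → x ≤ term k → ∃[ k ] term k < x × x ≤ term (suc k)
      go zero    x≤0 = contradiction 0<x x≤0
      go (suc k) x≤k with <⊎≥ (term k) x
      ... | inj₁ <x = k , <x , x≤k
      ... | inj₂ x≤ = go k x≤

  open CofinalSequence

  module _ {M S p} (s : CofinalSequence M S p) (c : Carrier M → Carrier M → ℕ) {m} (c<m : ∀ x y → c x y ℕ.< m) where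
    open Order M

    monochromaticSubsequence : ∃₂ λ (s′ : CofinalSequence M S p) t → ∀ k → c (term s′ k) (term s′ (suc k)) ≡ t
    monochromaticSubsequence with monochromaticPath m (λ i j → c (term s i) (term s j)) (λ _ _ → c<m _ _)
    ... | g , t , g-mono , mono = record
      { term = term s ∘ g ; start = ≤-trans (start s) (monotone s z≤n) ; inside = inside s ∘ g
      ; increasing = λ k → strictly-monotone s (g-mono k)
      ; cofinal = λ Sx → let k , x<k = cofinal s Sx in k , <-≤-trans x<k (monotone s (k≤g k))
      } , t , mono
      where
      k≤g : ∀ k → k ℕ.≤ g k
      k≤g zero    = z≤n
      k≤g (suc k) = ℕ.≤-<-trans (k≤g k) (g-mono k)

  -- Step `k` passes above the element with code `k` if that element lies in `S` beyond the current
  -- term; every element of `S` is exceeded once its code has been reached.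
  cofinalSequence : ∀ M → Countable M → ∀ {S p} → S p → (∀ x → S x → ∃[ y ] S y × Order._<_ M x y) →
                    CofinalSequence M S p
  cofinalSequence M M↣ℕ {S} {p} Sp unb = record
    { term = proj₁ ∘ seq ; start = ≤-refl ; inside = proj₂ ∘ seq
    ; increasing = λ k → proj₁ (proj₂ (next k (seq k)))
    ; cofinal = λ {x} Sx → suc (code x) , proj₂ (proj₂ (next (code x) (seq (code x)))) x refl Sx
    }
    where
    open Order M
    code = Injection.to M↣ℕ

    next : ∀ k (a : ∃ S) → Σ (∃ S) λ b → proj₁ a < proj₁ b × (∀ x → code x ≡ k → S x → x < proj₁ b)
    next k (a , Sa) with em 0ℓ {∃[ x ] code x ≡ k × S x × a < x}
    ... | yes (x , refl , Sx , a<x) = let y , Sy , x<y = unb x Sx in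
      (y , Sy) , <-trans a<x x<y , λ x′ eq _ → subst (_< y) (sym (Injection.injective M↣ℕ eq)) x<y
    ... | no none = let y , Sy , a<y = unb a Sa in
      (y , Sy) , a<y , λ x eq Sx → ≤-<-trans (λ a<x → none (x , eq , Sx , a<x)) a<y

    seq : ℕ → ∃ S
    seq zero    = p , Sp
    seq (suc k) = proj₁ (next k (seq k))

-- Approximation by members of 𝕄

module Approximation (em : ∀ ℓ → ExcludedMiddle ℓ) (n : ℕ) (K : LinearOrder) (K↣ℕ : Countable K) where
  open Classical em
  open FiniteIndex em
  open Restriction em K
  open Order K
  open BackAndForth em
  open CofinalSequence

  Good : LinearOrder → Set₁
  Good M = ∃[ N ] N ∈ 𝕄 × ⟦ N ⟧ ≈[ n ] ⟦ M ⟧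

  good-≅ : ∀ {M N} → M ≅ N → Good M → Good N
  good-≅ {M} {N} M≅N (L , L∈ , L≈M) = L , L∈ , ≈-trans L≈M (≈-iso n {M} {N} M≅N λ ())

  good-∑ : ∀ I {M N} → (∀ i → ⟦ N i ⟧ ≈[ n ] ⟦ M i ⟧) → ∑ I N ∈ 𝕄 → Good (∑ I M)
  good-∑ I {M} {N} N≈M ∑N∈ = ∑ I N , ∑N∈ ,
    ≈-∑ I {s = Vec.[]} {t = Vec.[]} λ i →
      ≈-trans (≈-resp n (N i) λ ()) (≈-trans (N≈M i) (≈-resp n (M i) λ ()))

  -- The empty set satisfies this vacuously, so the parts into which a set is cut may be empty
  -- although orders may not.
  Ok : Pred (Carrier K) 0ℓ → Set₁
  Ok S = (s : ∃ S) → Good (K ↾ s)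

  ok-resp : ∀ {S T} → S ⊆ T → T ⊆ S → Ok S → Ok T
  ok-resp S⊆T T⊆S okS (x , Tx) = good-≅ (↾-cong (x , T⊆S Tx) (x , Tx) S⊆T T⊆S) (okS (x , T⊆S Tx))

  ok-point : ∀ a → Ok ｛ a ｝
  ok-point a s = good-≅ (≅-intro {𝟏} {K ↾ s} (const (a ∣ refl)) (λ { {0F} {0F} () }) λ y → 0F , Sub-≡ (member y))
                        (𝟏 , one , ≈-refl)

  ok-∪ : ∀ {S T} → (∀ {x y} → S x → T y → x < y) → Ok S → Ok T → Ok (S ∪ T)
  ok-∪ {S} {T} S<T okS okT u with em 0ℓ {∃ S} | em 0ℓ {∃ T}
  ... | no ¬S | _     = ok-resp inj₂ [ (λ Sx → contradiction (_ , Sx) ¬S) , id ]′ okT u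
  ... | _     | no ¬T = ok-resp inj₁ [ id , (λ Tx → contradiction (_ , Tx) ¬T) ]′ okS u
  ... | yes s | yes t =
    good-≅ (glue 𝟐 F pt u (λ { false → inj₁ ; true → inj₂ }) [ (false ,_) , (true ,_) ]′ λ { f<t → S<T })
      (let M , M∈ , M≈ = okS s ; N , N∈ , N≈ = okT t in
       good-∑ 𝟐 {N = λ b → if b then N else M} (λ { false → M≈ ; true → N≈ }) (sum M∈ N∈))
    where
    F : Bool → Pred (Carrier K) 0ℓ
    F b = if b then T else S
    pt : ∀ b → ∃ (F b)
    pt false = s
    pt true  = t

  -- The default 0 for the empty set differs from every value of `colour`.
  colourOf : Pred (Carrier K) 0ℓ → ℕ
  colourOf S with em 0ℓ {∃ S}
  ... | yes s = toℕ (colour n (K ↾ s))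
  ... | no _  = 0

  colourOf< : ∀ S → colourOf S ℕ.< suc (colours n)
  colourOf< S with em 0ℓ {∃ S}
  ... | yes s = Fin.toℕ<n (colour n (K ↾ s))
  ... | no _  = s≤s z≤n

  colourOf⇒≈ : ∀ {S T} → colourOf S ≡ colourOf T → (s : ∃ S) (t : ∃ T) → ⟦ K ↾ s ⟧ ≈[ n ] ⟦ K ↾ t ⟧
  colourOf⇒≈ {S} {T} eq s t with em 0ℓ {∃ S} | em 0ℓ {∃ T}
  ... | no ¬S  | _      = contradiction s ¬S
  ... | _      | no ¬T  = contradiction t ¬T
  ... | yes s′ | yes t′ =
    ≈-trans (≈-iso n {K ↾ s} {K ↾ s′} (↾-cong s s′ id id) λ ())
    (≈-trans (colour⇒≈ n {K ↾ s′} {K ↾ t′} (Fin.toℕ-injective eq))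
             (≈-iso n {K ↾ t′} {K ↾ t} (↾-cong t′ t id id) λ ()))

  -- All pieces have one type, so the member `N` of `𝕄` found for a single piece stands in for each
  -- of them, and `N · I` for their sum.
  ok-stack : ∀ I → (∀ {M} → M ∈ 𝕄 → M · I ∈ 𝕄) → (T : Carrier I → Pred (Carrier K) 0ℓ) (pt : ∀ i → ∃ (T i)) →
             (∀ {i j x y} → Order._<_ I i j → T i x → T j y → x < y) →
             ∀ {t} → (∀ i → colourOf (T i) ≡ t) → (∀ i → Ok (T i)) →
             ∀ {S} → (∀ i → T i ⊆ S) → (∀ {x} → S x → ∃[ i ] T i x) → Ok S
  ok-stack I times T pt ordered mono okT T⊆S cover s =
    let i₀ = LinearOrder.inhabited I
        N , N∈ , N≈ = okT i₀ (pt i₀)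
    in good-≅ (glue I T pt s T⊆S cover ordered)
         (good-∑ I {N = const N}
           (λ i → ≈-trans N≈ (colourOf⇒≈ (trans (mono i₀) (sym (mono i))) (pt i₀) (pt i))) (times N∈))

  Ico : Carrier K → Carrier K → Pred (Carrier K) 0ℓ
  Ico a b x = a ≤ x × x < b

  Convex : Pred (Carrier K) 0ℓ → Set
  Convex S = ∀ {x y z} → S x → S z → x ≤ y → y ≤ z → S y

  Clique : Pred (Carrier K) 0ℓ → Set₁
  Clique S = ∀ {a b} → S a → S b → Ok (Ico a b)

  Ico-ok : ∀ {a b} → (a < b → Ok (Ico a b)) → Ok (Ico a b)
  Ico-ok ok (x , a≤x , x<b) = ok (≤-<-trans a≤x x<b) (x , a≤x , x<b)

  Ico-split : ∀ {a b c} → a ≤ b → b ≤ c → Ok (Ico a b) → Ok (Ico b c) → Ok (Ico a c)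
  Ico-split {a} {b} {c} a≤b b≤c ab bc = ok-resp join part (ok-∪ (λ (_ , x<b) (b≤y , _) → <-≤-trans x<b b≤y) ab bc)
    where
    join : Ico a b ∪ Ico b c ⊆ Ico a c
    join (inj₁ (a≤x , x<b)) = a≤x , <-≤-trans x<b b≤c
    join (inj₂ (b≤x , x<c)) = ≤-trans a≤b b≤x , x<c
    part : Ico a c ⊆ Ico a b ∪ Ico b c
    part {x} (a≤x , x<c) with <⊎≥ x b
    ... | inj₁ x<b = inj₁ (a≤x , x<b)
    ... | inj₂ b≤x = inj₂ (b≤x , x<c)

  module _ {S} (convex : Convex S) (clique : Clique S) {p} (Sp : S p) where
    Upper Lower : Pred (Carrier K) 0ℓ
    Upper x = S x × p ≤ x
    Lower x = S x × x < p

    -- With a maximum `m` the set is the interval from `p` to `m` followed by the point `m`. Without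
    -- one it is an initial interval followed by ω intervals of one colour, cut at a cofinal
    -- sequence.
    upper-ok : Ok Upper
    upper-ok with em 0ℓ {∃[ m ] S m × (∀ x → S x → x ≤ m)}
    ... | yes (m , Sm , max) =
      ok-resp [ (λ (p≤x , x<m) → convex Sp Sm p≤x (asym x<m) , p≤x) , (λ { refl → Sm , max p Sp }) ]′
              (λ {x} (Sx , p≤x) → part Sx p≤x)
              (ok-∪ (λ { (_ , x<m) refl → x<m }) (clique Sp Sm) (ok-point m))
      where
      part : ∀ {x} → S x → p ≤ x → (Ico p m ∪ ｛ m ｝) x
      part {x} Sx p≤x with <⊎≥ x m
      ... | inj₁ x<m = inj₁ (p≤x , x<m)
      ... | inj₂ m≤x = inj₂ (≤-antisym m≤x (max x Sx))
    ... | no noMax = above-start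
      (monochromaticSubsequence (cofinalSequence K K↣ℕ Sp unb) (λ a b → colourOf (Ico a b)) (λ _ _ → colourOf< _))
      where
      unb : ∀ x → S x → ∃[ y ] S y × x < y
      unb x Sx = stable λ none → noMax (x , Sx , λ y Sy x<y → none (y , Sy , x<y))

      above-start : (∃₂ λ (s : CofinalSequence K S p) t → ∀ k → colourOf (Ico (term s k) (term s (suc k))) ≡ t) →
                    Ok Upper
      above-start (s , t , mono) =
        ok-resp [ (λ (p≤x , x<0) → convex Sp (inside s 0) p≤x (asym x<0) , p≤x) ,
                  (λ (Sx , 0≤x) → Sx , ≤-trans (start s) 0≤x) ]′
                part
                (ok-∪ (λ (_ , x<0) (_ , 0≤y) → <-≤-trans x<0 0≤y) (clique Sp (inside s 0)) tail-ok)
        where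
        part : Upper ⊆ Ico p (term s 0) ∪ (λ x → S x × term s 0 ≤ x)
        part {x} (Sx , p≤x) with <⊎≥ x (term s 0)
        ... | inj₁ x<0 = inj₁ (p≤x , x<0)
        ... | inj₂ 0≤x = inj₂ (Sx , 0≤x)

        tail-ok : Ok (λ x → S x × term s 0 ≤ x)
        tail-ok = ok-stack ω times-ω (λ k → Ico (term s k) (term s (suc k)))
          (λ k → term s k , ≤-refl , increasing s k)
          (λ i<j (_ , x<) (≤y , _) → <-≤-trans x< (≤-trans (monotone s i<j) ≤y))
          mono
          (λ k → clique (inside s k) (inside s (suc k)))
          (λ k (≤x , x<) → convex (inside s k) (inside s (suc k)) ≤x (asym x<) , ≤-trans (monotone s z≤n) ≤x)
          (λ (Sx , 0≤x) → bracket-≤< s Sx 0≤x)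

    -- As for `upper-ok` in the reversed order, except that a minimum already belongs to the
    -- half-open interval and is not added as a separate point.
    lower-ok : Ok Lower
    lower-ok with em 0ℓ {∃[ m ] S m × (∀ x → S x → m ≤ x)}
    ... | yes (m , Sm , min) =
      ok-resp (λ (m≤x , x<p) → convex Sm Sp m≤x (asym x<p) , x<p) (λ {x} (Sx , x<p) → min x Sx , x<p) (clique Sm Sp)
    ... | no noMin = below-start
      (monochromaticSubsequence (cofinalSequence (K ᵒᵖ) K↣ℕ Sp unb) (λ a b → colourOf (Ico b a)) (λ _ _ → colourOf< _))
      where
      unb : ∀ x → S x → ∃[ y ] S y × y < x
      unb x Sx = stable λ none → noMin (x , Sx , λ y Sy y<x → none (y , Sy , y<x))

      below-start : (∃₂ λ (s : CofinalSequence (K ᵒᵖ) S p) t → ∀ k → colourOf (Ico (term s (suc k)) (term s k)) ≡ t) →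
                    Ok Lower
      below-start (s , t , mono) =
        ok-resp [ (λ (Sx , x<0) → Sx , <-≤-trans x<0 (start s)) ,
                  (λ (0≤x , x<p) → convex (inside s 0) Sp 0≤x (asym x<p) , x<p) ]′
                part
                (ok-∪ (λ (_ , x<0) (0≤y , _) → <-≤-trans x<0 0≤y) tail-ok (clique (inside s 0) Sp))
        where
        part : Lower ⊆ (λ x → S x × x < term s 0) ∪ Ico (term s 0) p
        part {x} (Sx , x<p) with <⊎≥ x (term s 0)
        ... | inj₁ x<0 = inj₁ (Sx , x<0)
        ... | inj₂ 0≤x = inj₂ (0≤x , x<p)

        tail-ok : Ok (λ x → S x × x < term s 0)
        tail-ok = ok-stack (ω ᵒᵖ) times-ω* (λ k → Ico (term s (suc k)) (term s k))
          (λ k → term s (suc k) , ≤-refl , increasing s k)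
          (λ j<i (_ , x<) (≤y , _) → <-≤-trans x< (≤-trans (monotone s j<i) ≤y))
          mono
          (λ k → clique (inside s (suc k)) (inside s k))
          (λ k (≤x , x<) → convex (inside s (suc k)) (inside s k) ≤x (asym x<) , <-≤-trans x< (monotone s z≤n))
          (λ (Sx , x<0) → let k , x< , ≤x = bracket-<≤ s Sx x<0 in k , ≤x , x<)

  ok-convexClique : ∀ {S} → Convex S → Clique S → Ok S
  ok-convexClique {S} convex clique (p , Sp) =
    ok-resp [ proj₁ , proj₁ ]′ part (ok-∪ (λ (_ , x<p) (_ , p≤y) → <-≤-trans x<p p≤y)
      (lower-ok convex clique Sp) (upper-ok convex clique Sp)) (p , Sp)
    where
    part : S ⊆ Lower convex clique Sp ∪ Upper convex clique Sp
    part {x} Sx with <⊎≥ x p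
    ... | inj₁ x<p = inj₁ (Sx , x<p)
    ... | inj₂ p≤x = inj₂ (Sx , p≤x)

  -- The relation `∼` and its classes

  between-left : ∀ {a b} → a ∈ Between a b
  between-left = ≤-refl ∘ proj₁ , ≤-refl ∘ proj₁

  between-right : ∀ {a b} → b ∈ Between a b
  between-right = ≤-refl ∘ proj₂ , ≤-refl ∘ proj₂

  between-convex : ∀ {a b} → Convex (Between a b)
  between-convex (x≮ , x≯) (z≮ , z≯) x≤y y≤z =
    (λ (y<a , y<b) → x≮ (≤-<-trans x≤y y<a , ≤-<-trans x≤y y<b)) ,
    (λ (a<y , b<y) → z≯ (<-≤-trans a<y y≤z , <-≤-trans b<y y≤z))

  between-⊆ : ∀ {a b c} → c ∈ Between a b → Between a c ⊆ Between a b
  between-⊆ (c≮ , c≯) {x} (x≮ , x≯) =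
    (λ (x<a , x<b) → c≮ (≤-<-trans (λ x<c → x≮ (x<a , x<c)) x<a , ≤-<-trans (λ x<c → x≮ (x<a , x<c)) x<b)) ,
    (λ (a<x , b<x) → c≯ (<-≤-trans a<x (λ c<x → x≯ (a<x , c<x)) , <-≤-trans b<x (λ c<x → x≯ (a<x , c<x))))

  between-split : ∀ {a c} b → Between a c ⊆ Between a b ∪ Between b c
  between-split {a} {c} b {x} (x≮ , x≯) with <⊎≥ x a | <⊎≥ x b | <⊎≥ a x | <⊎≥ b x
  ... | inj₁ x<a | inj₁ x<b | _        | _        = inj₂ ((λ (_ , x<c) → x≮ (x<a , x<c)) , λ (b<x , _) → asym x<b b<x)
  ... | _        | _        | inj₁ a<x | inj₁ b<x = inj₂ ((λ (x<b , _) → asym x<b b<x) , λ (_ , c<x) → x≯ (a<x , c<x))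
  ... | inj₂ a≤x | _        | inj₂ x≤a | _        = inj₁ (a≤x ∘ proj₁ , x≤a ∘ proj₁)
  ... | inj₂ a≤x | _        | _        | inj₂ x≤b = inj₁ (a≤x ∘ proj₁ , x≤b ∘ proj₂)
  ... | _        | inj₂ b≤x | inj₂ x≤a | _        = inj₁ (b≤x ∘ proj₂ , x≤a ∘ proj₁)
  ... | _        | inj₂ b≤x | _        | inj₂ x≤b = inj₁ (b≤x ∘ proj₂ , x≤b ∘ proj₂)

  clique-⊆ : ∀ {S T} → S ⊆ T → Clique T → Clique S
  clique-⊆ S⊆T clique Sa Sb = clique (S⊆T Sa) (S⊆T Sb)

  -- If the common point `y` lies between `a` and `b`, the interval is cut there. Otherwise
  -- convexity puts both ends into the same one of the two sets.
  clique-merge : ∀ {S T} → Convex S → Convex T → Clique S → Clique T → ∀ {y} → S y → T y →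
                 ∀ {a b} → S a → T b → Ok (Ico a b)
  clique-merge cS cT kS kT {y} Sy Ty {a} {b} Sa Tb = Ico-ok λ a<b → cases a<b (<⊎≥ y a) (<⊎≥ b y)
    where
    cases : a < b → y < a ⊎ a ≤ y → b < y ⊎ y ≤ b → Ok (Ico a b)
    cases a<b (inj₁ y<a) _          = kT (cT Ty Tb (asym y<a) (asym a<b)) Tb
    cases a<b _          (inj₁ b<y) = kS Sa (cS Sa Sy (asym a<b) (asym b<y))
    cases a<b (inj₂ a≤y) (inj₂ y≤b) = Ico-split a≤y y≤b (kS Sa Sy) (kT Ty Tb)

  infix 4 _∼_ _≁_
  -- Clique lives in Set₁; its truth value is taken so that ∼ classes are sets.
  record _∼_ (a b : Carrier K) : Set where
    constructor ∼-witness
    field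
      witness : True (em (lsuc 0ℓ) {Clique (Between a b)})

  _≁_ : Carrier K → Carrier K → Set
  a ≁ b = ¬ a ∼ b

  ∼-clique : ∀ {a b} → a ∼ b → Clique (Between a b)
  ∼-clique = toWitness ∘ _∼_.witness

  clique-∼ : ∀ {a b} → Clique (Between a b) → a ∼ b
  clique-∼ = ∼-witness ∘ fromWitness

  ∼-refl : ∀ {a} → a ∼ a
  ∼-refl = clique-∼ λ x∈ y∈ → Ico-ok λ x<y →
    contradiction (≤-<-trans (proj₁ (between-≤ x∈ ≤-refl)) x<y) (proj₂ (between-≤ y∈ ≤-refl))

  ∼-sym : ∀ {a b} → a ∼ b → b ∼ a
  ∼-sym a∼b = clique-∼ (clique-⊆ between-sym (∼-clique a∼b))

  ∼-trans : ∀ {a b c} → a ∼ b → b ∼ c → a ∼ c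
  ∼-trans {a} {b} {c} a∼b b∼c = clique-∼ λ x∈ y∈ → cases (between-split b x∈) (between-split b y∈)
    where
    cases : ∀ {x y} → (Between a b ∪ Between b c) x → (Between a b ∪ Between b c) y → Ok (Ico x y)
    cases (inj₁ x∈) (inj₁ y∈) = ∼-clique a∼b x∈ y∈
    cases (inj₂ x∈) (inj₂ y∈) = ∼-clique b∼c x∈ y∈
    cases (inj₁ x∈) (inj₂ y∈) =
      clique-merge between-convex between-convex (∼-clique a∼b) (∼-clique b∼c) between-right between-left x∈ y∈
    cases (inj₂ x∈) (inj₁ y∈) =
      clique-merge between-convex between-convex (∼-clique b∼c) (∼-clique a∼b) between-left between-right x∈ y∈

  ∼-between : ∀ {a b c} → a ∼ b → c ∈ Between a b → a ∼ c
  ∼-between a∼b c∈ = clique-∼ (clique-⊆ (between-⊆ c∈) (∼-clique a∼b))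

  class-convex : ∀ a → Convex (a ∼_)
  class-convex a a∼x a∼z x≤y y≤z = ∼-trans a∼x (∼-between (∼-trans (∼-sym a∼x) a∼z) (between⁺ x≤y y≤z))

  class-clique : ∀ a → Clique (a ∼_)
  class-clique a a∼x a∼y = ∼-clique (∼-trans (∼-sym a∼x) a∼y) between-left between-right

  class-ordered : ∀ {a b x y} → a < b → a ≁ b → a ∼ x → b ∼ y → x < y
  class-ordered {a} {b} {x} {y} a<b a≁b a∼x b∼y with <⊎≥ x y
  ... | inj₁ x<y = x<y
  ... | inj₂ y≤x with <⊎≥ x b
  ...   | inj₁ x<b = contradiction (∼-trans a∼x (∼-sym (class-convex b b∼y ∼-refl y≤x (asym x<b)))) a≁b
  ...   | inj₂ b≤x = contradiction (class-convex a ∼-refl a∼x (asym a<b) b≤x) a≁b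

  -- What remains between `a` and `b` once their own classes are removed. By `mid-saturated` it is a
  -- union of whole classes.
  Mid : Carrier K → Carrier K → Pred (Carrier K) 0ℓ
  Mid a b x = (a < x × x < b) × a ≁ x × b ≁ x

  mid-mono : ∀ {a b c d} → a ≤ c → d ≤ b → Mid c d ⊆ Mid a b
  mid-mono a≤c d≤b ((c<x , x<d) , c≁x , d≁x) =
    (≤-<-trans a≤c c<x , <-≤-trans x<d d≤b) ,
    (λ a∼x → c≁x (∼-trans (∼-sym (class-convex _ ∼-refl a∼x a≤c (asym c<x))) a∼x)) ,
    (λ b∼x → d≁x (∼-trans (∼-sym (class-convex _ b∼x ∼-refl (asym x<d) d≤b)) b∼x))

  mid-saturated : ∀ {a b x y} → Mid a b x → x ∼ y → Mid a b y
  mid-saturated ((a<x , x<b) , a≁x , b≁x) x∼y =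
    (class-ordered a<x a≁x ∼-refl x∼y , class-ordered x<b (b≁x ∘ ∼-sym) x∼y ∼-refl) ,
    (λ a∼y → a≁x (∼-trans a∼y (∼-sym x∼y))) , (λ b∼y → b≁x (∼-trans b∼y (∼-sym x∼y)))

  -- For inequivalent `c < d` the interval from `c` to `d` is an upper part of the class of `c`,
  -- then `Mid c d`, then a lower part of the class of `d`. The outer two are good since classes are
  -- convex cliques.
  bridge : ∀ {a b} → a ≤ b → (∀ {c d} → a ≤ c → c < d → d ≤ b → c ≁ d → Ok (Mid c d)) → a ∼ b
  bridge {a} {b} a≤b mid = clique-∼ λ c∈ d∈ → Ico-ok λ c<d →
    cases c<d (proj₁ (between-≤ c∈ a≤b)) (proj₂ (between-≤ d∈ a≤b)) (em 0ℓ)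
    where
    cases : ∀ {c d} → c < d → a ≤ c → d ≤ b → Dec (c ∼ d) → Ok (Ico c d)
    cases c<d a≤c d≤b (yes c∼d) = ∼-clique c∼d between-left between-right
    cases {c} {d} c<d a≤c d≤b (no c≁d) =
      ok-resp join part
        (ok-∪ {Upper (class-convex c) (class-clique c) ∼-refl}
          (λ { (c∼x , _) (inj₁ ((c<y , _) , c≁y , _)) → class-ordered c<y c≁y c∼x ∼-refl
             ; (c∼x , _) (inj₂ (d∼y , _)) → class-ordered c<d c≁d c∼x d∼y })
          (upper-ok (class-convex c) (class-clique c) ∼-refl)
          (ok-∪ {T = Lower (class-convex d) (class-clique d) ∼-refl}
            (λ ((_ , x<d) , _ , d≁x) (d∼y , _) → class-ordered x<d (d≁x ∘ ∼-sym) ∼-refl d∼y)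
            (mid a≤c c<d d≤b c≁d)
            (lower-ok (class-convex d) (class-clique d) ∼-refl)))
      where
      Parts : Pred (Carrier K) 0ℓ
      Parts = (λ x → c ∼ x × c ≤ x) ∪ (Mid c d ∪ (λ x → d ∼ x × x < d))

      join : Parts ⊆ Ico c d
      join (inj₁ (c∼x , c≤x))              = c≤x , class-ordered c<d c≁d c∼x ∼-refl
      join (inj₂ (inj₁ ((c<x , x<d) , _))) = asym c<x , x<d
      join (inj₂ (inj₂ (d∼x , x<d)))       = asym (class-ordered c<d c≁d ∼-refl d∼x) , x<d

      part : Ico c d ⊆ Parts
      part {x} (c≤x , x<d) with em 0ℓ {c ∼ x} | em 0ℓ {d ∼ x}
      ... | yes c∼x | _       = inj₁ (c∼x , c≤x)
      ... | no _    | yes d∼x = inj₂ (inj₂ (d∼x , x<d))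
      ... | no c≁x  | no d≁x  = inj₂ (inj₁ ((c<x , x<d) , c≁x , d≁x))
        where
        c<x : c < x
        c<x = stable λ c≮x → c≁x (subst (c ∼_) (≤-antisym c≤x c≮x) ∼-refl)

  -- Density of the classes: were `Mid a b` empty, so would be every `Mid c d` inside, and `bridge`
  -- would make `a` and `b` equivalent.
  mid-nonempty : ∀ {a b} → a < b → a ≁ b → ∃ (Mid a b)
  mid-nonempty a<b a≁b = stable λ none → a≁b (bridge (asym a<b) λ a≤c _ d≤b _ (x , m) →
    contradiction (x , mid-mono a≤c d≤b m) none)

  -- Representatives and colours of the classes

  code : Carrier K → ℕ
  code = Injection.to K↣ℕ

  -- Least code in the class: a definable choice of one point per class, so the order of the classes
  -- is a suborder of `K`.
  Canonical : Pred (Carrier K) 0ℓ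
  Canonical a = ∀ b → a ∼ b → code a ℕ.≤ code b

  canonical : ∀ a → ∃[ r ] a ∼ r × Canonical r
  canonical a =
    let r , a∼r , min = minimal code (a , ∼-refl) in r , a∼r , λ b r∼b → min b (∼-trans a∼r r∼b)

  canonical-unique : ∀ {a b} → Canonical a → Canonical b → a ∼ b → a ≡ b
  canonical-unique {a} {b} ca cb a∼b =
    Injection.injective K↣ℕ (ℕ.≤-antisym (ca b a∼b) (cb a (∼-sym a∼b)))

  canonical-≁ : ∀ {a b} → Canonical a → Canonical b → a < b → a ≁ b
  canonical-≁ ca cb a<b a∼b = irrefl (canonical-unique ca cb a∼b) a<b

  classColour : Carrier K → ℕ
  classColour a = colourOf (a ∼_)

  Point : Carrier K → Carrier K → Pred (Carrier K) 0ℓ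
  Point a b x = Canonical x × Mid a b x

  -- Only canonical points count: points of one class need not have the same
  -- classColour, since colour is not invariant under isomorphism.
  Occurs : ℕ → Carrier K → Carrier K → Set
  Occurs t a b = ∃[ x ] Point a b x × classColour x ≡ t

  occurs-mono : ∀ {t a b c d} → a ≤ c → d ≤ b → Occurs t c d → Occurs t a b
  occurs-mono a≤c d≤b (x , (cx , m) , eq) = x , (cx , mid-mono a≤c d≤b m) , eq

  -- Density in the order of the classes, hence asked only between points of different classes.
  DenseColour : ℕ → Carrier K → Carrier K → Set
  DenseColour t a b = ∀ {c d} → a ≤ c → c < d → d ≤ b → c ≁ d → Occurs t c d

  record Homogeneous (m : ℕ) (a b : Carrier K) : Set where
    field
      left right : Carrier K
      a≤left     : a ≤ left
      right≤b    : right ≤ b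
      left<right : left < right
      left≁right : left ≁ right
      colours-dense : ∀ {t} → t ℕ.< m → ¬ Occurs t left right ⊎ DenseColour t left right

  -- Colours are settled one at a time. If a subinterval with inequivalent ends omits colour `m`,
  -- shrinking to it makes `m` absent; if there is none, `m` is dense already. Absence and density
  -- both pass to such subintervals, so earlier colours stay settled.
  homogeneous : ∀ m {a b} → a < b → a ≁ b → Homogeneous m a b
  homogeneous zero {a} {b} a<b a≁b = record
    { left = a ; right = b ; a≤left = ≤-refl ; right≤b = ≤-refl
    ; left<right = a<b ; left≁right = a≁b ; colours-dense = λ () }
  homogeneous (suc m) {a} {b} a<b a≁b = refine (em 0ℓ)
    where
    open Homogeneous (homogeneous m a<b a≁b)

    Gap : Set
    Gap = ∃₂ λ c d → left ≤ c × c < d × d ≤ right × c ≁ d × ¬ Occurs m c d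

    refine : Dec Gap → Homogeneous (suc m) a b
    refine (yes (c , d , l≤c , c<d , d≤r , c≁d , absent)) = record
      { left = c ; right = d ; a≤left = ≤-trans a≤left l≤c ; right≤b = ≤-trans d≤r right≤b
      ; left<right = c<d ; left≁right = c≁d ; colours-dense = dense′ }
      where
      dense′ : ∀ {t} → t ℕ.< suc m → ¬ Occurs t c d ⊎ DenseColour t c d
      dense′ t<1+m with ℕ.m≤n⇒m<n∨m≡n (ℕ.≤-pred t<1+m)
      ... | inj₂ refl = inj₁ absent
      ... | inj₁ t<m with colours-dense t<m
      ...   | inj₁ none  = inj₁ (none ∘ occurs-mono l≤c d≤r)
      ...   | inj₂ dense = inj₂ λ c≤x x<y y≤d → dense (≤-trans l≤c c≤x) x<y (≤-trans y≤d d≤r)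
    refine (no noGap) = record
      { left = left ; right = right ; a≤left = a≤left ; right≤b = right≤b
      ; left<right = left<right ; left≁right = left≁right ; colours-dense = dense′ }
      where
      dense′ : ∀ {t} → t ℕ.< suc m → ¬ Occurs t left right ⊎ DenseColour t left right
      dense′ t<1+m with ℕ.m≤n⇒m<n∨m≡n (ℕ.≤-pred t<1+m)
      ... | inj₁ t<m  = colours-dense t<m
      ... | inj₂ refl = inj₂ λ l≤c c<d d≤r c≁d → stable λ absent → noGap (_ , _ , l≤c , c<d , d≤r , c≁d , absent)

  class : ∀ a → ∃ (a ∼_)
  class a = a , ∼-refl

  abstract
    class-good : ∀ a → Good (K ↾ class a)
    class-good a = ok-convexClique (class-convex a) (class-clique a) (class a)

  -- The canonical points of `Mid l r` are one for each class in it. They form a countable dense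
  -- order without ends, so the classes can be indexed by ℚ.
  module Shuffle {l r} (l<r : l < r) (l≁r : l ≁ r)
                 (colours-dense : ∀ {t} → Occurs t l r → DenseColour t l r) where
    point : ∀ {a b} → a < b → a ≁ b → ∃ (Point a b)
    point a<b a≁b =
      let x , m = mid-nonempty a<b a≁b
          y , x∼y , cy = canonical x
      in y , cy , mid-saturated m x∼y

    abstract
      p₀ : ∃ (Point l r)
      p₀ = point l<r l≁r

    L : LinearOrder
    L = K ↾ p₀

    L-unbounded : Unbounded L
    L-unbounded .Unbounded.above x =
      let cx , (l<x , x<r) , l≁x , r≁x = member {Point l r} x
          y , cy , m@((x<y , _) , _) = point x<r (r≁x ∘ ∼-sym)
      in (y ∣ (cy , mid-mono (asym l<x) ≤-refl m)) , x<y
    L-unbounded .Unbounded.below x =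
      let cx , (l<x , x<r) , l≁x , r≁x = member {Point l r} x
          y , cy , m@((_ , y<x) , _) = point l<x l≁x
      in (y ∣ (cy , mid-mono ≤-refl (asym x<r) m)) , y<x

    L-≁ : ∀ (x y : Carrier L) → elem x < elem y → elem x ≁ elem y
    L-≁ x y = canonical-≁ (proj₁ (member {Point l r} x)) (proj₁ (member {Point l r} y))

    lift-point : ∀ (x y : Carrier L) {z} → Point (elem x) (elem y) z → Point l r z
    lift-point x y (cz , m) =
      let _ , (l<x , _) , _ = member {Point l r} x ; _ , (_ , y<r) , _ = member {Point l r} y
      in cz , mid-mono (asym l<x) (asym y<r) m

    L-dense : ∀ (x y : Carrier L) → elem x < elem y → ∃[ z ] elem x < elem {P = Point l r} z × elem z < elem y
    L-dense x y x<y =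
      let z , pz@(_ , (x<z , z<y) , _) = point x<y (L-≁ x y x<y) in (z ∣ lift-point x y pz) , x<z , z<y

    abstract
      η≅L : η ≅ L
      -- Every pair matches, which is Cantor's theorem without colours.
      η≅L = proj₁ (backAndForth η L η-countable (sub-countable K p₀ K↣ℕ) η-unbounded L-unbounded (λ _ _ → ⊤)
        (λ _ {x} {y} x<y → let z , x<z , z<y = L-dense x y x<y in z , tt , x<z , z<y)
        (λ _ p<q → let z , p<z , z<q = ℚ.<-dense p<q in z , tt , p<z , z<q))

    open Iso {η} {L} η≅L

    at : ℚ → Carrier K
    at q = elem (fun q)

    Occurring : ℕ → Set
    Occurring t = ∃[ x ] classColour (elem {P = Point l r} x) ≡ t

    x₀ : Carrier L
    x₀ = Order.inhabited L

    pick : ℕ → Carrier L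
    pick t with em 0ℓ {Occurring t}
    ... | yes (x , _) = x
    ... | no _        = x₀

    pick-colour : ∀ {t} → Occurring t → classColour (elem (pick t)) ≡ t
    pick-colour {t} occ with em 0ℓ {Occurring t}
    ... | yes (_ , eq) = eq
    ... | no ¬occ      = contradiction occ ¬occ

    -- Every index of a shuffle must occur densely, so the colours that do not occur
    -- are sent to one that does.
    normal : ℕ → ℕ
    normal t with em 0ℓ {Occurring t}
    ... | yes _ = t
    ... | no _  = classColour (elem x₀)

    normal-occurs : ∀ t → Occurring (normal t)
    normal-occurs t with em 0ℓ {Occurring t}
    ... | yes occ = occ
    ... | no _    = x₀ , refl

    normal-id : ∀ {t} → Occurring t → normal t ≡ t
    normal-id {t} occ with em 0ℓ {Occurring t}
    ... | yes _   = refl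
    ... | no ¬occ = contradiction occ ¬occ

    -- One member of `𝕄` per colour, taken from a sample class: different classes of one colour
    -- might come with different approximations, and a shuffle of finitely many orders is required.
    N : ℕ → LinearOrder
    N t = proj₁ (class-good (elem (pick t)))

    N-cong : ∀ {s t} → s ≡ t → N s ≅ N t
    N-cong {s} refl = ≅-refl {N s}

    shuffle-of : IsShuffleOf {suc (colours n)} (λ i → N (normal (toℕ i))) (λ q → N (classColour (at q)))
    shuffle-of .IsShuffleOf.covered q = fromℕ< (colourOf< _) , N-cong (sym (trans
      (cong normal (Fin.toℕ-fromℕ< (colourOf< _))) (normal-id (fun q , refl))))
    shuffle-of .IsShuffleOf.dense i {p} {q} p<q =
      let z , eq = normal-occurs (toℕ i)
          _ , (l<p , _) , _ = member {Point l r} (fun p) ; _ , (_ , q<r) , _ = member {Point l r} (fun q)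
          -- The colour `normal (toℕ i)` occurs somewhere, hence also strictly between the classes
          -- at `p` and `q`.
          x , px@(_ , (p<x , x<q) , _) , x-colour = colours-dense (elem z , member {Point l r} z , eq)
            (asym l<p) (mono p<q) (asym q<r) (L-≁ (fun p) (fun q) (mono p<q))
          y = x ∣ lift-point (fun p) (fun q) px
      in inv y , N-cong (trans (cong (classColour ∘ elem) (fun-inv y)) x-colour) ,
         subst (ℚ._< inv y) (inv-fun p) (inv-mono p<x) , subst (inv y ℚ.<_) (inv-fun q) (inv-mono x<q)

    -- The set is the sum over ℚ of its classes, and replacing each class by the sample order of its
    -- colour turns this sum into a shuffle.
    mid-ok : Ok (Mid l r)
    mid-ok s = good-≅
      (glue η (λ q → at q ∼_) (class ∘ at) s
        (λ q → mid-saturated (proj₂ (member {Point l r} (fun q))))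
        (λ {x} m → let y , x∼y , cy = canonical x ; z = y ∣ (cy , mid-saturated m x∼y) in
          inv z , subst (λ z → elem z ∼ x) (sym (fun-inv z)) (∼-sym x∼y))
        (λ {p} {q} p<q → class-ordered (mono p<q) (L-≁ (fun p) (fun q) (mono p<q))))
      (good-∑ η {N = λ q → N (classColour (at q))}
        (λ q → ≈-trans (proj₂ (proj₂ (class-good (elem (pick (classColour (at q)))))))
          (colourOf⇒≈ (pick-colour (fun q , refl)) (class _) (class (at q))))
        (shuffle {M = λ i → N (normal (toℕ i))} (λ i → proj₁ (proj₂ (class-good (elem (pick (normal (toℕ i)))))))
          shuffle-of))

  -- Inequivalent points would enclose a homogeneous interval. Each `Mid c d` in it with
  -- inequivalent ends is then equivalent to a shuffle, and `bridge` contradicts the inequivalence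
  -- of its ends.
  all-∼ : ∀ {a b} → a < b → a ∼ b
  all-∼ {a} {b} a<b = stable λ a≁b →
    -- All values of `colourOf` lie below this bound, so every colour is settled.
    let open Homogeneous (homogeneous (suc (colours n)) a<b a≁b) in
    left≁right (bridge (asym left<right) λ {c} {d} l≤c c<d d≤r c≁d →
      -- A colour that occurs between `c` and `d` occurs between `left` and `right`, which leaves
      -- only the dense alternative.
      Shuffle.mid-ok c<d c≁d λ occ@(_ , _ , eq) l′≤x x<y y≤r′ →
        [ (λ absent → contradiction (occurs-mono l≤c d≤r occ) absent)
        , (λ dense → dense (≤-trans l≤c l′≤x) x<y (≤-trans y≤r′ d≤r)) ]′
        (colours-dense (subst (ℕ._< suc (colours n)) eq (colourOf< _))))

  good : Good K
  good = good-≅ (↾-U all _) (ok-convexClique (λ _ _ _ _ → _)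
    (λ _ _ → Ico-ok λ a<b → ∼-clique (all-∼ a<b) between-left between-right) all)
    where
    all : ∃ U
    all = inhabited , _

theorem1p4 : (∀ ℓ → ExcludedMiddle ℓ) →
    (M : LinearOrder) →
    M ∈ 𝕄 ⇔ (Countable M × ∃[ ψ ] M ⊨ ψ × Categorical≤ℵ₀ ψ)
theorem1p4 em M = mk⇔
  (λ M∈𝕄 → 𝕄⇒countable M∈𝕄 , Rigidity.𝕄⇒categorical em M∈𝕄)
  (λ (M↣ℕ , ψ , M⊨ψ , categorical) →
    let N , N∈𝕄 , N≈M = Approximation.good em (rank ψ) M M↣ℕ
    in iso (categorical N M (𝕄⇒countable N∈𝕄) M↣ℕ (≈⇒⊨ ψ (≈-sym N≈M) M⊨ψ) M⊨ψ) N∈𝕄)
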